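{- Let $G=(V,E)$ be a finite undirected graph with $n$ vertices, let $k\ge 1$ be an integer, let $\alpha\ge 1$ be a real number, and let $W\subseteq V$ satisfy $|W|<(\alpha+1)k$. Then the recursive algorithm $\mathrm{Triangulate}(G,W,k)$ (defined in the context, with parameter $\alpha$) either triangulates $G$, by adding edges, in such a way that the vertices of $W$ form a clique and the size of a largest clique of the triangulated graph is $<(2\alpha+1)k$, or it correctly outputs that the cliquewidth of $G$ is larger than $k$.
   Context: A triangulation of a graph $G$ is a chordal graph on the same vertex set obtained from $G$ by adding edges (a graph is chordal, or triangulated, if every cycle of length more than three has a chord). The cliquewidth of $G$ is the minimum, over all triangulations $H$ of $G$, of the number of vertices of a largest clique of $H$ (equivalently treewidth plus 1; equivalently the size of the largest clique in a junction tree of $G$ in which this size is minimized). $G[S]$ denotes the subgraph induced by $S$. A decomposition of $G=(V,E)$ is a partition $(X,A,B,C)$ of $V$ with $A$ and $B$ non-empty ($X$ and $C$ may be empty) such that there are no edges of $G$ between any two of the sets $A,B,C$. Given an integer $k\ge1$, a real $\alpha\ge1$, a graph $G=(V,E)$ with $|V|\ge(2\alpha+1)k$, and $W\subseteq V$, a decomposition $(X,A,B,C)$ of $G$ is a $W$-decomposition with respect to $(k,\alpha)$ if $|W|<(\alpha+1)k$, $|X|\le\alpha k$, $|(W\cap A)\cup X|<(\alpha+1)k$, $|(W\cap B)\cup X|<(\alpha+1)k$ and $|(W\cap C)\cup X|<(\alpha+1)k$. Algorithm $\mathrm{Triangulate}(G,W,k)$ with $G=(V,E)$: If $|V|<(2\alpha+1)k$,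 make $V$ a clique. Otherwise, find a $W$-decomposition $(X,A,B,C)$ of $G$ with respect to $(k,\alpha)$; if none is found (the search finds one whenever one exists), return "cliquewidth $>k$". Otherwise set $W_A=W\cap A$, $W_B=W\cap B$, $W_C=W\cap C$; call $\mathrm{Triangulate}(G[A\cup X],W_A\cup X,k)$, $\mathrm{Triangulate}(G[B\cup X],W_B\cup X,k)$ and $\mathrm{Triangulate}(G[C\cup X],W_C\cup X,k)$; then make $W\cup X$ a clique. The triangulated graph is $G$ together with all edges added in this call and in all recursive calls. If any recursive call returns "cliquewidth $>k$", so does the whole algorithm. -}

module Defs where

open import Algebra.Bundles using (RawMonoid)
import Algebra.Definitions.RawMonoid as RawMonoidDefs
open import Data.Fin.Base using (Fin; toℕ)
open import Data.Fin.Subset using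
  (Subset; _∈_; _⊆_; _∩_; _∪_; ∣_∣; Nonempty)
open import Data.Fin.Subset.Properties using
  (_∈?_; x∈p∪q⁺; x∈p∪q⁻; x∈p∩q⁻; p⊂q⇒∣p∣<∣q∣)
open import Data.Fin.Properties using () renaming (_≟_ to _≟ᶠ_)
open import Data.Integer.Base using (+_)
open import Data.Integer.Solver using () renaming (module +-*-Solver to ℤ-Solver)
open import Data.Nat.Base as ℕ using (ℕ; suc)
open import Data.Nat.DivMod using (_mod_)
open import Data.Nat.Induction using (Acc; acc; <-wellFounded)
open import Data.Product.Base using (_×_; _,_; ∃-syntax; ∃₂; proj₂)
open import Data.Rational.Base as ℚ using (ℚ; toℚᵘ)
import Data.Rational.Properties as ℚ
open import Data.Rational.Solver using () renaming (module +-*-Solver to ℚ-Solver)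
open import Data.Rational.Unnormalised.Base as ℚᵘ using (mkℚᵘ; *≡*)
import Data.Rational.Unnormalised.Properties as ℚᵘ
open import Data.Sum.Base as Sum using (_⊎_; inj₁; inj₂; [_,_]′)
open import Function.Base using (_∘_; id)
open import Function.Definitions using (Injective)
open import Level using (0ℓ)
open import Relation.Binary.Core using (Rel)
open import Relation.Binary.Definitions using (Symmetric; Irreflexive; Decidable)
open import Relation.Binary.PropositionalEquality using
  (_≡_; _≢_; refl; sym; cong; cong₂; subst)
open import Relation.Nullary using (¬_; Dec; yes; no)
open import Relation.Nullary.Decidable using (_×-dec_; _⊎-dec_; ¬?)

-- Bishop's real numbers: regular sequences of rationals.

δ : ℕ → ℚ
δ n = + 1 ℚ./ suc n

record ℝ : Set where
  constructor mkℝ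
  field
    seq     : ℕ → ℚ
    regular : ∀ m n → ℚ.∣ seq m ℚ.- seq n ∣ ℚ.≤ δ m ℚ.+ δ n

open ℝ public

infix 4 _<ℝ_ _≤ℝ_ _≈ℝ_
infixl 6 _+ℝ_

-- The n-th approximations of x and y are each off by at most δ n, so a gap
-- exceeding δ n + δ n separates the limits.
_<ℝ_ : Rel ℝ 0ℓ
x <ℝ y = ∃[ n ] seq x n ℚ.+ (δ n ℚ.+ δ n) ℚ.< seq y n

_≤ℝ_ : Rel ℝ 0ℓ
x ≤ℝ y = ¬ (y <ℝ x)

_≈ℝ_ : Rel ℝ 0ℓ
x ≈ℝ y = x ≤ℝ y × y ≤ℝ x

abstract
  δ≥0 : ∀ n → ℚ.0ℚ ℚ.≤ δ n
  δ≥0 n = ℚ.nonNegative⁻¹ (δ n) {{ℚ.normalize-nonNeg 1 (suc n)}}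

  const-regular : ∀ q m n → ℚ.∣ q ℚ.- q ∣ ℚ.≤ δ m ℚ.+ δ n
  const-regular q m n =
    subst (λ z → ℚ.∣ z ∣ ℚ.≤ δ m ℚ.+ δ n) (sym (ℚ.+-inverseʳ q))
          (ℚ.+-mono-≤ (δ≥0 m) (δ≥0 n))

fromℚ : ℚ → ℝ
fromℚ q = mkℝ (λ _ → q) (const-regular q)

fromℕ : ℕ → ℝ
fromℕ n = fromℚ (+ n ℚ./ 1)

0ℝ 1ℝ : ℝ
0ℝ = fromℕ 0
1ℝ = fromℕ 1

-- suc (double n) = 2 (n + 1), hence δ (double n) is half of δ n.
double : ℕ → ℕ
double n = n ℕ.+ suc n

abstract
  δ-double : ∀ n → δ (double n) ℚ.+ δ (double n) ≡ δ n
  δ-double n = ℚ.toℚᵘ-injective (begin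
    toℚᵘ (δ (double n) ℚ.+ δ (double n))
      ≈⟨ ℚ.toℚᵘ-homo-+ (δ (double n)) (δ (double n)) ⟩
    toℚᵘ (δ (double n)) ℚᵘ.+ toℚᵘ (δ (double n))
      ≈⟨ ℚᵘ.+-cong (ℚ.toℚᵘ-fromℚᵘ (mkℚᵘ (+ 1) (double n)))
                   (ℚ.toℚᵘ-fromℚᵘ (mkℚᵘ (+ 1) (double n))) ⟩
    mkℚᵘ (+ 1) (double n) ℚᵘ.+ mkℚᵘ (+ 1) (double n)
      ≈⟨ *≡* (ℤ-Solver.solve 1
           (λ d → let open ℤ-Solver in
             (con (+ 1) :* (d :+ d) :+ con (+ 1) :* (d :+ d)) :* d
               := con (+ 1) :* ((d :+ d) :* (d :+ d)))
           refl (+ suc n)) ⟩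
    mkℚᵘ (+ 1) n
      ≈⟨ ℚᵘ.≃-sym (ℚ.toℚᵘ-fromℚᵘ (mkℚᵘ (+ 1) n)) ⟩
    toℚᵘ (δ n) ∎)
    where open ℚᵘ.≃-Reasoning

  +-regular : ∀ x y m n →
    ℚ.∣ (seq x (double m) ℚ.+ seq y (double m)) ℚ.-
        (seq x (double n) ℚ.+ seq y (double n)) ∣ ℚ.≤ δ m ℚ.+ δ n
  +-regular x y m n = begin
    ℚ.∣ (a ℚ.+ b) ℚ.- (c ℚ.+ d) ∣
      ≡⟨ cong ℚ.∣_∣ (solve 4 (λ a b c d →
           (a :+ b) :- (c :+ d) := (a :- c) :+ (b :- d)) refl a b c d) ⟩
    ℚ.∣ (a ℚ.- c) ℚ.+ (b ℚ.- d) ∣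
      ≤⟨ ℚ.∣p+q∣≤∣p∣+∣q∣ (a ℚ.- c) (b ℚ.- d) ⟩
    ℚ.∣ a ℚ.- c ∣ ℚ.+ ℚ.∣ b ℚ.- d ∣
      ≤⟨ ℚ.+-mono-≤ (regular x (double m) (double n)) (regular y (double m) (double n)) ⟩
    (μ ℚ.+ ν) ℚ.+ (μ ℚ.+ ν)
      ≡⟨ solve 2 (λ μ ν → (μ :+ ν) :+ (μ :+ ν) := (μ :+ μ) :+ (ν :+ ν)) refl μ ν ⟩
    (μ ℚ.+ μ) ℚ.+ (ν ℚ.+ ν)
      ≡⟨ cong₂ ℚ._+_ (δ-double m) (δ-double n) ⟩
    δ m ℚ.+ δ n ∎
    where
    open ℚ.≤-Reasoning
    open ℚ-Solver
    a b c d μ ν : ℚ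
    a = seq x (double m)
    b = seq y (double m)
    c = seq x (double n)
    d = seq y (double n)
    μ = δ (double m)
    ν = δ (double n)

_+ℝ_ : ℝ → ℝ → ℝ
x +ℝ y = mkℝ (λ n → seq x (double n) ℚ.+ seq y (double n)) (+-regular x y)

+-rawMonoid : RawMonoid 0ℓ 0ℓ
+-rawMonoid = record { Carrier = ℝ ; _≈_ = _≈ℝ_ ; _∙_ = _+ℝ_ ; ε = 0ℝ }

-- n · x is the n-fold sum of x; every product of reals needed below, such as
-- (2α + 1)k, has a natural number as a factor.
open RawMonoidDefs +-rawMonoid using () renaming (_×_ to _·_) public

------------------------------------------------------------------------

-- A finite simple graph with vertex set V.  Taking V inside a fixed Fin n lets
-- a graph, its induced subgraphs and its triangulations share vertex names.
record Graph {n} (V : Subset n) : Set₁ where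
  field
    Adj     : Rel (Fin n) 0ℓ
    adj?    : Decidable Adj
    adj-sym : Symmetric Adj
    irrefl  : Irreflexive _≡_ Adj
    within  : ∀ {u v} → Adj u v → u ∈ V × v ∈ V

open Graph public

module _ {n : ℕ} where

  infixl 8 _[_]

  _[_] : {V : Subset n} → Graph V → (S : Subset n) → Graph S
  G [ S ] = record
    { Adj     = λ u v → Adj G u v × u ∈ S × v ∈ S
    ; adj?    = λ u v → adj? G u v ×-dec (u ∈? S) ×-dec (v ∈? S)
    ; adj-sym = λ (e , u∈ , v∈) → adj-sym G e , v∈ , u∈
    ; irrefl  = λ eq (e , _) → irrefl G eq e
    ; within  = proj₂
    }

  complete : (S : Subset n) → Graph S
  complete S = record
    { Adj     = λ u v → u ≢ v × u ∈ S × v ∈ S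
    ; adj?    = λ u v → ¬? (u ≟ᶠ v) ×-dec (u ∈? S) ×-dec (v ∈? S)
    ; adj-sym = λ (u≢v , u∈ , v∈) → u≢v ∘ sym , v∈ , u∈
    ; irrefl  = λ eq (u≢v , _) → u≢v eq
    ; within  = proj₂
    }

  addEdges : {V S : Subset n} → Graph V → S ⊆ V → Graph S → Graph V
  addEdges G S⊆V F = record
    { Adj     = λ u v → Adj G u v ⊎ Adj F u v
    ; adj?    = λ u v → adj? G u v ⊎-dec adj? F u v
    ; adj-sym = Sum.map (adj-sym G) (adj-sym F)
    ; irrefl  = λ eq → [ irrefl G eq , irrefl F eq ]′
    ; within  = [ within G , (λ (u∈ , v∈) → S⊆V u∈ , S⊆V v∈) ∘ within F ]′
    }

------------------------------------------------------------------------

cyclicSuc : ∀ {m} → Fin m → Fin m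
cyclicSuc {suc m} i = suc (toℕ i) mod suc m

module _ {n : ℕ} {V : Subset n} where

  IsClique : Graph V → Subset n → Set
  IsClique G S = S ⊆ V × (∀ {u v} → u ∈ S → v ∈ S → u ≢ v → Adj G u v)

  LargestCliqueSize : Graph V → ℕ → Set
  LargestCliqueSize G m =
    (∃[ S ] IsClique G S × ∣ S ∣ ≡ m) × (∀ S → IsClique G S → ∣ S ∣ ℕ.≤ m)

  -- A cycle of length m, given by its vertices in cyclic order (for m ≥ 3).
  IsCycle : Graph V → {m : ℕ} → (Fin m → Fin n) → Set
  IsCycle G c = Injective _≡_ _≡_ c × (∀ i → Adj G (c i) (c (cyclicSuc i)))

  HasChord : Graph V → {m : ℕ} → (Fin m → Fin n) → Set
  HasChord G c = ∃₂ λ i j → j ≢ cyclicSuc i × i ≢ cyclicSuc j × Adj G (c i) (c j)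

  Chordal : Graph V → Set
  Chordal G = ∀ {m} (c : Fin m → Fin n) → 3 ℕ.< m → IsCycle G c → HasChord G c

  IsTriangulation : Graph V → Graph V → Set
  IsTriangulation G H = (∀ {u v} → Adj G u v → Adj H u v) × Chordal H

  IsCliquewidth : Graph V → ℕ → Set₁
  IsCliquewidth G w =
    (∃[ H ] IsTriangulation G H × LargestCliqueSize H w) ×
    (∀ H m → IsTriangulation G H → LargestCliqueSize H m → w ℕ.≤ m)

------------------------------------------------------------------------

module _ {n : ℕ} where

  DisjointSets : Subset n → Subset n → Set
  DisjointSets S T = ∀ {v} → v ∈ S → ¬ v ∈ T

  W∩S∪X⊆S∪X : ∀ (W S X : Subset n) → (W ∩ S) ∪ X ⊆ S ∪ X
  W∩S∪X⊆S∪X W S X =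
    x∈p∪q⁺ ∘ Sum.map (λ v∈ → proj₂ (x∈p∩q⁻ W S v∈)) id ∘ x∈p∪q⁻ (W ∩ S) X

module _ {n : ℕ} {V : Subset n} where

  NoEdgesBetween : Graph V → Subset n → Subset n → Set
  NoEdgesBetween G S T = ∀ {u v} → u ∈ S → v ∈ T → ¬ Adj G u v

  record Decomposition (G : Graph V) : Set where
    field
      X A B C    : Subset n
      partition  : X ∪ A ∪ B ∪ C ≡ V
      X∩A=∅      : DisjointSets X A
      X∩B=∅      : DisjointSets X B
      X∩C=∅      : DisjointSets X C
      A∩B=∅      : DisjointSets A B
      A∩C=∅      : DisjointSets A C
      B∩C=∅      : DisjointSets B C
      A-nonempty : Nonempty A
      B-nonempty : Nonempty B
      A-B        : NoEdgesBetween G A B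
      A-C        : NoEdgesBetween G A C
      B-C        : NoEdgesBetween G B C

  record IsWDecomposition (k : ℕ) (α : ℝ) {G : Graph V} (W : Subset n)
                          (D : Decomposition G) : Set where
    open Decomposition D
    field
      W-small  : fromℕ ∣ W ∣           <ℝ k · (α +ℝ 1ℝ)
      X-small  : fromℕ ∣ X ∣           ≤ℝ k · α
      WA-small : fromℕ ∣ (W ∩ A) ∪ X ∣ <ℝ k · (α +ℝ 1ℝ)
      WB-small : fromℕ ∣ (W ∩ B) ∪ X ∣ <ℝ k · (α +ℝ 1ℝ)
      WC-small : fromℕ ∣ (W ∩ C) ∪ X ∣ <ℝ k · (α +ℝ 1ℝ)

  WDecomposition : ℕ → ℝ → Graph V → Subset n → Set
  WDecomposition k α G W = ∃[ D ] IsWDecomposition k α {G} W D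

  module _ {G : Graph V} (D : Decomposition G) where
    open Decomposition D

    private
      in-V : ∀ {v} → v ∈ X ∪ A ∪ B ∪ C → v ∈ V
      in-V = subst (_ ∈_) partition

      ∪-lub : {S T : Subset n} → S ⊆ V → T ⊆ V → S ∪ T ⊆ V
      ∪-lub S⊆V T⊆V = [ S⊆V , T⊆V ]′ ∘ x∈p∪q⁻ _ _

    X⊆V : X ⊆ V
    X⊆V = in-V ∘ x∈p∪q⁺ ∘ inj₁

    A⊆V : A ⊆ V
    A⊆V = in-V ∘ x∈p∪q⁺ ∘ inj₂ ∘ x∈p∪q⁺ ∘ inj₁

    B⊆V : B ⊆ V
    B⊆V = in-V ∘ x∈p∪q⁺ ∘ inj₂ ∘ x∈p∪q⁺ ∘ inj₂ ∘ x∈p∪q⁺ ∘ inj₁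

    C⊆V : C ⊆ V
    C⊆V = in-V ∘ x∈p∪q⁺ ∘ inj₂ ∘ x∈p∪q⁺ ∘ inj₂ ∘ x∈p∪q⁺ ∘ inj₂

    A∪X⊆V : A ∪ X ⊆ V
    A∪X⊆V = ∪-lub A⊆V X⊆V

    B∪X⊆V : B ∪ X ⊆ V
    B∪X⊆V = ∪-lub B⊆V X⊆V

    C∪X⊆V : C ∪ X ⊆ V
    C∪X⊆V = ∪-lub C⊆V X⊆V

    W∪X⊆V : ∀ {W} → W ⊆ V → W ∪ X ⊆ V
    W∪X⊆V W⊆V = ∪-lub W⊆V X⊆V

    private
      smaller : ∀ {S v} → S ⊆ V → v ∈ V → ¬ v ∈ S → ∣ S ∣ ℕ.< ∣ V ∣
      smaller S⊆V v∈V v∉S = p⊂q⇒∣p∣<∣q∣ (S⊆V , _ , v∈V , v∉S)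

      ∉-∪ : ∀ {S T : Subset n} {v} → ¬ v ∈ S → ¬ v ∈ T → ¬ v ∈ S ∪ T
      ∉-∪ v∉S v∉T = [ v∉S , v∉T ]′ ∘ x∈p∪q⁻ _ _

    ∣A∪X∣<∣V∣ : ∣ A ∪ X ∣ ℕ.< ∣ V ∣
    ∣A∪X∣<∣V∣ = let (_ , b∈B) = B-nonempty in
      smaller A∪X⊆V (B⊆V b∈B) (∉-∪ (λ b∈A → A∩B=∅ b∈A b∈B) (λ b∈X → X∩B=∅ b∈X b∈B))

    ∣B∪X∣<∣V∣ : ∣ B ∪ X ∣ ℕ.< ∣ V ∣
    ∣B∪X∣<∣V∣ = let (_ , a∈A) = A-nonempty in
      smaller B∪X⊆V (A⊆V a∈A) (∉-∪ (A∩B=∅ a∈A) (λ a∈X → X∩A=∅ a∈X a∈A))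

    ∣C∪X∣<∣V∣ : ∣ C ∪ X ∣ ℕ.< ∣ V ∣
    ∣C∪X∣<∣V∣ = let (_ , a∈A) = A-nonempty in
      smaller C∪X⊆V (A⊆V a∈A) (∉-∪ (A∩C=∅ a∈A) (λ a∈X → X∩A=∅ a∈X a∈A))

------------------------------------------------------------------------

-- The two primitive operations the algorithm relies on.  Comparing a vertex
-- count with the real (2α + 1)k is decidable only classically, so the test is a
-- parameter.  The search finds a W-decomposition whenever there is one; which
-- one it finds is left open.

SizeTest : ℕ → ℝ → Set
SizeTest k α = ∀ m → Dec (fromℕ m <ℝ k · (2 · α +ℝ 1ℝ))

Search : ℕ → ℕ → ℝ → Set₁
Search n k α =
  ∀ {V : Subset n} (G : Graph V) → k · (2 · α +ℝ 1ℝ) ≤ℝ fromℕ ∣ V ∣ →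
  ∀ W → W ⊆ V → Dec (WDecomposition k α G W)

data Outcome {n} (V : Subset n) : Set₁ where
  triangulated  : Graph V → Outcome V
  cliquewidth>k : Outcome V

module _ {n : ℕ} (k : ℕ) (α : ℝ) (small? : SizeTest k α) (search : Search n k α) where

  combine : {V : Subset n} (G : Graph V) (D : Decomposition G) →
            let open Decomposition D in
            ∀ W → W ⊆ V →
            Outcome (A ∪ X) → Outcome (B ∪ X) → Outcome (C ∪ X) → Outcome V
  combine G D W W⊆V (triangulated H₁) (triangulated H₂) (triangulated H₃) =
    triangulated
      (addEdges (addEdges (addEdges (addEdges G
        (A∪X⊆V D) H₁) (B∪X⊆V D) H₂) (C∪X⊆V D) H₃)
        (W∪X⊆V D W⊆V) (complete (W ∪ Decomposition.X D)))
  combine _ _ _ _ _ _ _ = cliquewidth>k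

  triangulateAcc : {V : Subset n} (G : Graph V) (W : Subset n) → W ⊆ V →
                   Acc ℕ._<_ ∣ V ∣ → Outcome V

  afterTest : {V : Subset n} (G : Graph V) (W : Subset n) → W ⊆ V →
              (∀ {m} → m ℕ.< ∣ V ∣ → Acc ℕ._<_ m) →
              Dec (fromℕ ∣ V ∣ <ℝ k · (2 · α +ℝ 1ℝ)) → Outcome V

  afterSearch : {V : Subset n} (G : Graph V) (W : Subset n) → W ⊆ V →
                (∀ {m} → m ℕ.< ∣ V ∣ → Acc ℕ._<_ m) →
                Dec (WDecomposition k α G W) → Outcome V

  triangulateAcc {V} G W W⊆V (acc rs) = afterTest G W W⊆V rs (small? ∣ V ∣)

  afterTest {V} G W W⊆V rs (yes _)    = triangulated (addEdges G id (complete V))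
  afterTest     G W W⊆V rs (no large) = afterSearch G W W⊆V rs (search G large W W⊆V)

  afterSearch G W W⊆V rs (no _)        = cliquewidth>k
  afterSearch G W W⊆V rs (yes (D , _)) = combine G D W W⊆V
    (triangulateAcc (G [ A ∪ X ]) ((W ∩ A) ∪ X) (W∩S∪X⊆S∪X W A X) (rs (∣A∪X∣<∣V∣ D)))
    (triangulateAcc (G [ B ∪ X ]) ((W ∩ B) ∪ X) (W∩S∪X⊆S∪X W B X) (rs (∣B∪X∣<∣V∣ D)))
    (triangulateAcc (G [ C ∪ X ]) ((W ∩ C) ∪ X) (W∩S∪X⊆S∪X W C X) (rs (∣C∪X∣<∣V∣ D)))
    where open Decomposition D

  triangulate : {V : Subset n} (G : Graph V) (W : Subset n) → W ⊆ V → Outcome V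
  triangulate {V} G W W⊆V = triangulateAcc G W W⊆V (<-wellFounded ∣ V ∣)

{-# OPTIONS --safe #-}

-- A graph has the property Dirac if, in every induced subgraph, a simplicial
-- vertex can be found outside any given clique not containing all its vertices.
-- This is equivalent to chordality, and, unlike chordality, it visibly survives
-- gluing along a clique.  The graph returned by Triangulate is glued from the
-- clique on W ∪ X and the three recursive results along the cliques
-- (W ∩ A) ∪ X, (W ∩ B) ∪ X and (W ∩ C) ∪ X; its cliques lie in one of the four
-- pieces, and ∣W ∪ X∣ < (α + 1)k + αk.
--
-- Conversely, let H be a chordal supergraph whose cliques have at most k < ∣V∣
-- vertices.  Start with X = ∅, U = V, and shrink U, keeping X a clique of H
-- that separates U from a rest meeting at most half of W.  If some x ∈ X has no
-- neighbour in U, it is moved to the rest; if U falls apart, then either both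
-- parts meet at most half of W or the heavier one replaces U; otherwise some
-- v ∈ U is adjacent to all of X and is moved to X.  This ends with a partition
-- (X, A, B, C) in which every part S meets at most half of W or S ∪ X is a
-- clique, which is a W-decomposition because α ≥ 1.

module Submission where

open import Defs
open import Algebra.Bundles using (CommutativeSemiring)
import Algebra.Solver.Ring.NaturalCoefficients.Default as SemiringSolver
open import Algebra.Structures using (IsCommutativeSemiring; IsCommutativeRing)
open import Data.Fin.Base using (Fin; zero; suc; toℕ; inject₁; remQuot)
  renaming (fromℕ to fromℕᶠ; combine to pair)
open import Data.Fin.Properties as Fin using
  (any?; toℕ-injective; toℕ<n; toℕ-fromℕ<; toℕ-fromℕ; toℕ-inject₁; remQuot-combine)
open import Data.Fin.Subset using
  (Subset; inside; outside; _∈_; _∉_; _⊆_; _∩_; _∪_; ∣_∣; Nonempty; ⊥; ⁅_⁆)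
open import Data.Fin.Subset.Properties using
  ( _∈?_; _⊆?_; nonempty?; anySubset?; ∉⊥; ∣⊥∣≡0; Empty-unique; ⊆-antisym
  ; x∈⁅x⁆; x∈⁅y⁆⇒x≡y; x∈p∩q⁺; x∈p∩q⁻; x∈p∪q⁺; x∈p∪q⁻
  ; p⊆q⇒∣p∣≤∣q∣; p⊂q⇒∣p∣<∣q∣; ∣p∩q∣≤∣q∣)
open import Data.Integer.Base as ℤ using () renaming (+_ to pos)
import Data.Integer.Properties as ℤ
open import Data.Integer.Solver using () renaming (module +-*-Solver to ℤ-Solver)
open import Data.Nat.Base as ℕ using (ℕ; zero; suc; _+_; _*_; _≤_; _<_; z≤n; s≤s)
open import Data.Nat.DivMod using
  (_%_; m%n<n; m<n⇒m%n≡m; n%n≡0; m%n%n≡m%n; [m+n]%n≡m%n; %-distribˡ-+)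
open import Data.Nat.Induction using (Acc; acc; <-wellFounded)
import Data.Nat.Properties as ℕ
open import Data.Product.Base using (_×_; _,_; ∃-syntax; proj₁; proj₂; swap)
open import Data.Rational.Base as ℚ using (ℚ; toℚᵘ; 0ℚ; 1ℚ)
import Data.Rational.Properties as ℚ
open import Data.Rational.Solver using () renaming (module +-*-Solver to ℚ-Solver)
open import Data.Rational.Unnormalised.Base as ℚᵘ using (mkℚᵘ; *≡*)
import Data.Rational.Unnormalised.Properties as ℚᵘ
open import Data.Sum.Base as Sum using (_⊎_; inj₁; inj₂; [_,_]′)
open import Data.Vec.Base using ([]; _∷_; tabulate)
open import Data.Vec.Properties using (lookup⇒[]=; []=⇒lookup; lookup∘tabulate)
open import Function.Base using (_∘_; id; case_of_)
open import Level using (0ℓ)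
open import Relation.Binary.Construct.Closure.ReflexiveTransitive as Star using
  (Star; _◅_; _◅◅_; reverse)
open import Relation.Binary.Definitions using (tri<; tri≈; tri>)
open import Relation.Binary.PropositionalEquality using
  (_≡_; _≢_; refl; sym; trans; cong; cong₂; subst; subst₂; module ≡-Reasoning)
open import Relation.Nullary using (¬_; Dec; yes; no; does; contradiction; decidable-stable)
open import Relation.Nullary.Decidable using
  (_×-dec_; _⊎-dec_; _→-dec_; ¬?; map′; dec-true)
open import Relation.Unary using (Pred; Decidable)

-- Comparing real multiples of α with vertex counts

-- The operations of ℚ unfold to gcd computations whenever terms are compared,
-- so they are sealed, and so are the rationals occurring in _<ℝ_.
infixl 6 _⊕_
infixl 7 _⊛_

opaque
  _⊕_ _⊛_ : ℚ → ℚ → ℚ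
  _⊕_ = ℚ._+_
  _⊛_ = ℚ._*_

  ι : ℕ → ℚ
  ι n = pos n ℚ./ 1

  ε : ℕ → ℚ
  ε = δ

  ⊕-⊛-isCommutativeSemiring : IsCommutativeSemiring _≡_ _⊕_ _⊛_ 0ℚ 1ℚ
  ⊕-⊛-isCommutativeSemiring = IsCommutativeRing.isCommutativeSemiring ℚ.+-*-isCommutativeRing

  ⊕-mono-≤ : ∀ {p q r s} → p ℚ.≤ q → r ℚ.≤ s → p ⊕ r ℚ.≤ q ⊕ s
  ⊕-mono-≤ = ℚ.+-mono-≤

  ⊕-mono-<-≤ : ∀ {p q r s} → p ℚ.< q → r ℚ.≤ s → p ⊕ r ℚ.< q ⊕ s
  ⊕-mono-<-≤ = ℚ.+-mono-<-≤

  ⊛-monoʳ-≤ : ∀ {p q} r → 0ℚ ℚ.≤ r → p ℚ.≤ q → r ⊛ p ℚ.≤ r ⊛ q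
  ⊛-monoʳ-≤ r 0≤r = ℚ.*-monoˡ-≤-nonNeg r {{ℚ.nonNegative 0≤r}}

  ι-+ : ∀ a b → ι (a ℕ.+ b) ≡ ι a ⊕ ι b
  ι-+ a b = ℚ.toℚᵘ-injective (begin
    toℚᵘ (ι (a ℕ.+ b))                  ≈⟨ toℚᵘ-ι (a ℕ.+ b) ⟩
    mkℚᵘ (pos (a ℕ.+ b)) 0                ≈⟨ *≡* (ℤ-Solver.solve 2
      (λ a b → let open ℤ-Solver in
        (a :+ b) :* con (pos 1) := (a :* con (pos 1) :+ b :* con (pos 1)) :* con (pos 1))
      refl (pos a) (pos b)) ⟩
    mkℚᵘ (pos a) 0 ℚᵘ.+ mkℚᵘ (pos b) 0      ≈⟨ ℚᵘ.+-cong (toℚᵘ-ι a) (toℚᵘ-ι b) ⟨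
    toℚᵘ (ι a) ℚᵘ.+ toℚᵘ (ι b)          ≈⟨ ℚ.toℚᵘ-homo-+ (ι a) (ι b) ⟨
    toℚᵘ (ι a ℚ.+ ι b)                  ∎)
    where
    open ℚᵘ.≃-Reasoning
    toℚᵘ-ι : ∀ n → toℚᵘ (ι n) ℚᵘ.≃ mkℚᵘ (pos n) 0
    toℚᵘ-ι n = ℚ.toℚᵘ-fromℚᵘ (mkℚᵘ (pos n) 0)

  -- The witness satisfies `suc m = suc N * suc c`. With it a coarse margin `ε N` becomes an exact
  -- multiple of a fine error `ε m`, so that errors can be counted in units.
  archimedean : ∀ c N → ∃[ m ] ι (suc c) ⊛ ε m ≡ ε N
  archimedean c N = m , ℚ.toℚᵘ-injective (begin
    toℚᵘ (ι (suc c) ℚ.* δ m)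
      ≈⟨ ℚ.toℚᵘ-homo-* (ι (suc c)) (δ m) ⟩
    toℚᵘ (ι (suc c)) ℚᵘ.* toℚᵘ (δ m)
      ≈⟨ ℚᵘ.*-cong (ℚ.toℚᵘ-fromℚᵘ (mkℚᵘ (pos (suc c)) 0)) (ℚ.toℚᵘ-fromℚᵘ (mkℚᵘ (pos 1) m)) ⟩
    mkℚᵘ (pos (suc c)) 0 ℚᵘ.* mkℚᵘ (pos 1) m
      ≈⟨ *≡* (trans (ℤ-Solver.solve 2
           (λ a b → let open ℤ-Solver in
             (a :* con (pos 1)) :* b := con (pos 1) :* (b :* a))
           refl (pos (suc c)) (pos (suc N)))
           (cong (pos 1 ℤ.*_) (trans (sym (ℤ.pos-* (suc N) (suc c)))
                                   (cong pos (sym (ℕ.+-identityʳ (suc m))))))) ⟩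
    mkℚᵘ (pos 1) N
      ≈⟨ ℚ.toℚᵘ-fromℚᵘ (mkℚᵘ (pos 1) N) ⟨
    toℚᵘ (δ N) ∎)
    where
    open ℚᵘ.≃-Reasoning
    m : ℕ
    m = c ℕ.+ N ℕ.* suc c

  ε-halves : ∀ n → ε (double n) ⊕ ε (double n) ≡ ε n
  ε-halves = δ-double

  regular-≤ : ∀ x m n → seq x m ℚ.≤ seq x n ⊕ (ε m ⊕ ε n)
  regular-≤ x m n = begin
    seq x m                                ≡⟨ ℚ-Solver.solve 2 (λ a b →
        let open ℚ-Solver in a := b :+ (a :- b)) refl (seq x m) (seq x n) ⟩
    seq x n ℚ.+ (seq x m ℚ.- seq x n)      ≤⟨ ℚ.+-monoʳ-≤ (seq x n) (p≤∣p∣ _) ⟩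
    seq x n ℚ.+ ℚ.∣ seq x m ℚ.- seq x n ∣  ≤⟨ ℚ.+-monoʳ-≤ (seq x n) (regular x m n) ⟩
    seq x n ℚ.+ (δ m ℚ.+ δ n)              ∎
    where
    open ℚ.≤-Reasoning
    p≤∣p∣ : ∀ p → p ℚ.≤ ℚ.∣ p ∣
    p≤∣p∣ p with ℚ.≤-total 0ℚ p
    ... | inj₁ 0≤p = ℚ.≤-reflexive (sym (ℚ.0≤p⇒∣p∣≡p 0≤p))
    ... | inj₂ p≤0 = ℚ.≤-trans p≤0 (ℚ.0≤∣p∣ p)

  fromℕ<ℝ⁺ : ∀ {i} y n → ι i ⊕ (ε n ⊕ ε n) ℚ.< seq y n → fromℕ i <ℝ y
  fromℕ<ℝ⁺ y n lt = n , lt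

  fromℕ<ℝ⁻ : ∀ {i} y → fromℕ i <ℝ y → ∃[ n ] ι i ⊕ (ε n ⊕ ε n) ℚ.< seq y n
  fromℕ<ℝ⁻ y i<y = i<y

  <ℝfromℕ⁺ : ∀ {i} y n → seq y n ⊕ (ε n ⊕ ε n) ℚ.< ι i → y <ℝ fromℕ i
  <ℝfromℕ⁺ y n lt = n , lt

  <ℝfromℕ⁻ : ∀ {i} y → y <ℝ fromℕ i → ∃[ n ] seq y n ⊕ (ε n ⊕ ε n) ℚ.< ι i
  <ℝfromℕ⁻ y y<i = y<i

  seq-fromℕ : ∀ i n → seq (fromℕ i) n ≡ ι i
  seq-fromℕ i n = refl

  ι≥0 : ∀ n → 0ℚ ℚ.≤ ι n
  ι≥0 n = ℚ.nonNegative⁻¹ (ι n) {{ℚ.normalize-nonNeg n 1}}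

  ε>0 : ∀ n → 0ℚ ℚ.< ε n
  ε>0 n = ℚ.positive⁻¹ (ε n) {{ℚ.normalize-pos 1 (suc n)}}

  ι0≡0 : ι 0 ≡ 0ℚ
  ι0≡0 = refl

  ι1≡1 : ι 1 ≡ 1ℚ
  ι1≡1 = refl

  ε0≡1 : ε 0 ≡ 1ℚ
  ε0≡1 = refl

  seq-+ : ∀ x y n → seq (x +ℝ y) n ≡ seq x (double n) ⊕ seq y (double n)
  seq-+ x y n = refl

⊕-⊛-commutativeSemiring : CommutativeSemiring 0ℓ 0ℓ
⊕-⊛-commutativeSemiring = record { isCommutativeSemiring = ⊕-⊛-isCommutativeSemiring }

open CommutativeSemiring ⊕-⊛-commutativeSemiring using
  (+-comm; +-identityˡ; +-identityʳ; *-identityˡ; *-identityʳ; zeroˡ; zeroʳ)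
open SemiringSolver ⊕-⊛-commutativeSemiring using (solve; _:=_; _:+_; _:*_; con)

ι-suc-⊛ : ∀ c d → ι (suc c) ⊛ d ≡ d ⊕ ι c ⊛ d
ι-suc-⊛ c d = trans (cong (_⊛ d) (trans (ι-+ 1 c) (cong (_⊕ ι c) ι1≡1)))
  (solve 2 (λ c d → (con 1 :+ c) :* d := d :+ c :* d) refl (ι c) d)

ι-⊕-⊛ : ∀ a b d → ι (a ℕ.+ b) ⊛ d ≡ ι a ⊛ d ⊕ ι b ⊛ d
ι-⊕-⊛ a b d = trans (cong (_⊛ d) (ι-+ a b))
  (solve 3 (λ a b d → (a :+ b) :* d := a :* d :+ b :* d) refl (ι a) (ι b) d)

ι-* : ∀ a b → ι (a ℕ.* b) ≡ ι a ⊛ ι b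
ι-* zero    b = trans ι0≡0 (sym (trans (cong (_⊛ ι b) ι0≡0) (zeroˡ (ι b))))
ι-* (suc a) b = trans (ι-+ b (a ℕ.* b))
  (trans (cong (ι b ⊕_) (ι-* a b)) (sym (ι-suc-⊛ a (ι b))))

≤-cancelʳ : ∀ {p q} r → p ⊕ r ℚ.≤ q ⊕ r → p ℚ.≤ q
≤-cancelʳ r p+r≤q+r = ℚ.≮⇒≥ λ q<p →
  ℚ.<-irrefl refl (ℚ.<-≤-trans (⊕-mono-<-≤ q<p ℚ.≤-refl) p+r≤q+r)

-- e ≤ f because f − e = b − a, with subtraction avoided.
linear : ∀ {a b e f} → a ℚ.≤ b → f ⊕ a ≡ e ⊕ b → e ℚ.≤ f
linear {a} {b} {e} {f} a≤b eq = ≤-cancelʳ b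
  (subst (ℚ._≤ f ⊕ b) eq (⊕-mono-≤ (ℚ.≤-refl {f}) a≤b))

≤-double⁻¹ : ∀ {p q} → p ⊕ p ℚ.≤ q ⊕ q → p ℚ.≤ q
≤-double⁻¹ p+p≤q+q = ℚ.≮⇒≥ λ q<p →
  ℚ.<-irrefl refl (ℚ.<-≤-trans (⊕-mono-<-≤ q<p (ℚ.<⇒≤ q<p)) p+p≤q+q)

ι-mono : ∀ {a b} → a ℕ.≤ b → ι a ℚ.≤ ι b
ι-mono {a} a≤b with ℕ.m≤n⇒∃[o]m+o≡n a≤b
... | c , refl = linear (ι≥0 c) (trans (+-identityʳ _) (ι-+ a c))

opaque
  unfolding ι

  <ℝ-downward : ∀ {i j x} → i ≤ j → fromℕ j <ℝ x → fromℕ i <ℝ x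
  <ℝ-downward i≤j (n , lt) = n , ℚ.≤-<-trans (ℚ.+-monoˡ-≤ _ (ι-mono i≤j)) lt

-- Inequalities between sequences up to an error of order ε m, in which the
-- order of the reals that the sequences converge to can be read off.

infix 4 _≲_ _⟶_ _⋖_

_≲_ : (f g : ℕ → ℚ) → Set
f ≲ g = ∃[ c ] ∀ m → f m ℚ.≤ g m ⊕ ι c ⊛ ε m

-- The margin `ε N` is fixed while the error vanishes as `m` grows, so this is strict inequality in
-- the limit.
_⋖_ : ℕ → (ℕ → ℚ) → Set
i ⋖ f = ∃[ N ] (λ _ → ι i ⊕ ε N) ≲ f

-- `f` may be any sequence of rationals: the error in `m` has an arbitrary constant factor, so sums
-- and multiples can be formed at one common index `m`, without the reindexing by `double` that
-- occurs in `_+ℝ_`.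
record _⟶_ (y : ℝ) (f : ℕ → ℚ) : Set where
  constructor converges
  field
    rate  : ℕ
    upper : ∀ n m → seq y n ℚ.≤ f m ⊕ (ε n ⊕ ι rate ⊛ ε m)
    lower : ∀ n m → f m ℚ.≤ seq y n ⊕ (ε n ⊕ ι rate ⊛ ε m)

<ℝ⇒⋖ : ∀ {y f i} → y ⟶ f → fromℕ i <ℝ y → i ⋖ f
<ℝ⇒⋖ {y} {f} {i} (converges c f≥ _) i<y = n , c , λ m →
  linear (⊕-mono-≤ (ℚ.<⇒≤ gap) (f≥ n m))
    (solve 5 (λ f e q d y → (f :+ e) :+ ((q :+ (d :+ d)) :+ y) :=
        (q :+ d) :+ (y :+ (f :+ (d :+ e))))
      refl (f m) (ι c ⊛ ε m) (ι i) (ε n) (seq y n))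
  where
  n : ℕ
  n = proj₁ (fromℕ<ℝ⁻ y i<y)
  gap : ι i ⊕ (ε n ⊕ ε n) ℚ.< seq y n
  gap = proj₂ (fromℕ<ℝ⁻ y i<y)

⋖⇒<ℝ : ∀ {y f i} → y ⟶ f → i ⋖ f → fromℕ i <ℝ y
⋖⇒<ℝ {y} {f} {i} (converges c _ f≤) (N , c′ , i≤f) =
  fromℕ<ℝ⁺ y m (ℚ.<-≤-trans strict bound)
  where
  m : ℕ
  -- The margin `ε N` is `4 + c + c′` units: two for the gap in `_<ℝ_`, one for its strictness, one
  -- for the distance of `seq y m` from the limit, and `c + c′` for the two errors.
  m = proj₁ (archimedean (3 ℕ.+ (c ℕ.+ c′)) N)
  q d e e′ : ℚ
  q = ι i
  d = ε m
  e = ι c ⊛ d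
  e′ = ι c′ ⊛ d
  εN≡ : ε N ≡ d ⊕ (d ⊕ (d ⊕ (d ⊕ (e ⊕ e′))))
  εN≡ = trans (sym (proj₂ (archimedean (3 ℕ.+ (c ℕ.+ c′)) N)))
    (trans (ι-suc-⊛ (3 ℕ.+ (c ℕ.+ c′)) d) (cong (d ⊕_)
    (trans (ι-suc-⊛ (2 ℕ.+ (c ℕ.+ c′)) d) (cong (d ⊕_)
    (trans (ι-suc-⊛ (1 ℕ.+ (c ℕ.+ c′)) d) (cong (d ⊕_)
    (trans (ι-suc-⊛ (c ℕ.+ c′) d) (cong (d ⊕_) (ι-⊕-⊛ c c′ d)))))))))
  strict : q ⊕ (d ⊕ d) ℚ.< d ⊕ (q ⊕ (d ⊕ d))
  strict = subst (ℚ._< d ⊕ (q ⊕ (d ⊕ d))) (+-identityˡ _) (⊕-mono-<-≤ (ε>0 m) ℚ.≤-refl)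
  bound : d ⊕ (q ⊕ (d ⊕ d)) ℚ.≤ seq y m
  bound = linear (⊕-mono-≤ (subst (λ z → q ⊕ z ℚ.≤ f m ⊕ e′) εN≡ (i≤f m)) (f≤ m m))
    (solve 6 (λ y q d f e e′ →
       y :+ ((q :+ (d :+ (d :+ (d :+ (d :+ (e :+ e′)))))) :+ f) :=
       (d :+ (q :+ (d :+ d))) :+ ((f :+ e′) :+ (y :+ (d :+ e))))
      refl (seq y m) q d (f m) e e′)

-- Of the rate `3 + c`, two units come from negating the gap in `_<ℝ_` and `1 + c` from comparing
-- `seq y m` with `f m`.
≤ℝ⇒≲ : ∀ {y f i} → y ⟶ f → fromℕ i ≤ℝ y → (λ _ → ι i) ≲ f
≤ℝ⇒≲ {y} {f} {i} (converges c f≥ _) i≤y = 3 ℕ.+ c , λ m →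
  subst (λ z → ι i ℚ.≤ f m ⊕ z) (sym (3+c m))
    (linear (⊕-mono-≤ (ℚ.≮⇒≥ λ lt → i≤y (<ℝfromℕ⁺ y m lt)) (f≥ m m))
      (solve 5 (λ f e d q y → (f :+ (d :+ (d :+ (d :+ e)))) :+ (q :+ y) :=
         q :+ ((y :+ (d :+ d)) :+ (f :+ (d :+ e))))
       refl (f m) (ι c ⊛ ε m) (ε m) (ι i) (seq y m)))
  where
  3+c : ∀ m → ι (3 ℕ.+ c) ⊛ ε m ≡ ε m ⊕ (ε m ⊕ (ε m ⊕ ι c ⊛ ε m))
  3+c m = trans (ι-suc-⊛ (2 ℕ.+ c) (ε m)) (cong (ε m ⊕_)
    (trans (ι-suc-⊛ (1 ℕ.+ c) (ε m)) (cong (ε m ⊕_) (ι-suc-⊛ c (ε m)))))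

-- A gap of `ε n ⊕ ε n` leaves one `ε n` after passing from `seq y n` to the limit. With `m` chosen
-- so that `ε n` is `1 + c + c′` units `ε m`, the errors use up only `c + c′` of them.
≲⇒≤ℝ : ∀ {y f i} → y ⟶ f → (λ _ → ι i) ≲ f → fromℕ i ≤ℝ y
≲⇒≤ℝ {y} {f} {i} (converges c _ f≤) (c′ , i≤f) y<i =
  ℚ.<-irrefl refl (ℚ.<-≤-trans gap
    (linear (⊕-mono-≤ (⊕-mono-≤ (i≤f m) (f≤ n m)) (ℚ.<⇒≤ (ε>0 m)))
      (trans (cong (λ z → (seq y n ⊕ (ε n ⊕ z)) ⊕ ((ι i ⊕ f m) ⊕ 0ℚ)) εn≡)
        (solve 7 (λ y D d e e′ q f →
           (y :+ (D :+ (d :+ (e :+ e′)))) :+ ((q :+ f) :+ con 0) :=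
           q :+ (((f :+ e′) :+ (y :+ (D :+ e))) :+ d))
         refl (seq y n) (ε n) (ε m) (ι c ⊛ ε m) (ι c′ ⊛ ε m) (ι i) (f m)))))
  where
  n m : ℕ
  n = proj₁ (<ℝfromℕ⁻ y y<i)
  m = proj₁ (archimedean (c ℕ.+ c′) n)
  gap : seq y n ⊕ (ε n ⊕ ε n) ℚ.< ι i
  gap = proj₂ (<ℝfromℕ⁻ y y<i)
  εn≡ : ε n ≡ ε m ⊕ (ι c ⊛ ε m ⊕ ι c′ ⊛ ε m)
  εn≡ = trans (sym (proj₂ (archimedean (c ℕ.+ c′) n)))
    (trans (ι-suc-⊛ (c ℕ.+ c′) (ε m)) (cong (ε m ⊕_) (ι-⊕-⊛ c c′ (ε m))))

⟶-resp : ∀ {y f g} → (∀ m → f m ≡ g m) → y ⟶ f → y ⟶ g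
⟶-resp {y} f≡g (converges c f≥ f≤) = converges c
  (λ n m → subst (λ z → seq y n ℚ.≤ z ⊕ (ε n ⊕ ι c ⊛ ε m)) (f≡g m) (f≥ n m))
  (λ n m → subst (λ z → z ℚ.≤ seq y n ⊕ (ε n ⊕ ι c ⊛ ε m)) (f≡g m) (f≤ n m))

fromℕ-⟶ : ∀ i → fromℕ i ⟶ λ _ → ι i
fromℕ-⟶ i = converges 0
  (λ n m → subst (ℚ._≤ ι i ⊕ (ε n ⊕ ι 0 ⊛ ε m)) (sym (seq-fromℕ i n)) (bound n m))
  (λ n m → subst (λ z → ι i ℚ.≤ z ⊕ (ε n ⊕ ι 0 ⊛ ε m)) (sym (seq-fromℕ i n)) (bound n m))
  where
  bound : ∀ n m → ι i ℚ.≤ ι i ⊕ (ε n ⊕ ι 0 ⊛ ε m)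
  bound n m = linear (ℚ.<⇒≤ (ε>0 n))
    (trans (cong (λ z → (ι i ⊕ (ε n ⊕ z ⊛ ε m)) ⊕ 0ℚ) ι0≡0)
      (solve 3 (λ q d e → (q :+ (d :+ con 0 :* e)) :+ con 0 := q :+ d)
        refl (ι i) (ε n) (ε m)))

seq-⟶ : ∀ x → x ⟶ seq x
seq-⟶ x = converges 1
  (λ n m → subst (λ z → seq x n ℚ.≤ seq x m ⊕ (ε n ⊕ z)) (sym (1⊛ (ε m))) (regular-≤ x n m))
  (λ n m → subst (λ z → seq x m ℚ.≤ seq x n ⊕ z)
    (trans (+-comm (ε m) (ε n)) (cong (ε n ⊕_) (sym (1⊛ (ε m))))) (regular-≤ x m n))
  where
  1⊛ : ∀ d → ι 1 ⊛ d ≡ d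
  1⊛ d = trans (cong (_⊛ d) ι1≡1) (*-identityˡ d)

+-⟶ : ∀ {x y f g} → x ⟶ f → y ⟶ g → x +ℝ y ⟶ λ m → f m ⊕ g m
+-⟶ {x} {y} {f} {g} (converges c f≥ f≤) (converges c′ g≥ g≤) = converges (c ℕ.+ c′)
  (λ n m → subst₂ (λ z r → z ℚ.≤ (f m ⊕ g m) ⊕ r)
    (sym (seq-+ x y n)) (sym (error n m)) (regroup (f≥ (double n) m) (g≥ (double n) m)))
  (λ n m → subst₂ (λ z r → f m ⊕ g m ℚ.≤ z ⊕ r)
    (sym (seq-+ x y n)) (sym (error n m)) (regroup (f≤ (double n) m) (g≤ (double n) m)))
  where
  error : ∀ n m → ε n ⊕ ι (c ℕ.+ c′) ⊛ ε m ≡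
                  (ε (double n) ⊕ ι c ⊛ ε m) ⊕ (ε (double n) ⊕ ι c′ ⊛ ε m)
  error n m = trans (cong₂ _⊕_ (sym (ε-halves n)) (ι-⊕-⊛ c c′ (ε m)))
    (solve 3 (λ d e e′ → (d :+ d) :+ (e :+ e′) := (d :+ e) :+ (d :+ e′))
      refl (ε (double n)) (ι c ⊛ ε m) (ι c′ ⊛ ε m))
  regroup : ∀ {p q u v r s} → p ℚ.≤ u ⊕ r → q ℚ.≤ v ⊕ s → p ⊕ q ℚ.≤ (u ⊕ v) ⊕ (r ⊕ s)
  regroup {p} {q} {u} {v} {r} {s} p≤ q≤ = subst (p ⊕ q ℚ.≤_)
    (solve 4 (λ u v r s → (u :+ r) :+ (v :+ s) := (u :+ v) :+ (r :+ s)) refl u v r s)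
    (⊕-mono-≤ p≤ q≤)

·-⟶ : ∀ k {x f} → x ⟶ f → k · x ⟶ λ m → ι k ⊛ f m
·-⟶ zero    {f = f} x⟶f = ⟶-resp
  (λ m → trans ι0≡0 (sym (trans (cong (_⊛ f m) ι0≡0) (zeroˡ (f m))))) (fromℕ-⟶ 0)
·-⟶ (suc k) {f = f} x⟶f = ⟶-resp (λ m → sym (ι-suc-⊛ k (f m))) (+-⟶ x⟶f (·-⟶ k x⟶f))

-- Inequalities between the size bounds that follow from α ≥ 1

module Bounds (k : ℕ) (1≤k : 1 ℕ.≤ k) (α : ℝ) (1≤α : 1ℝ ≤ℝ α) where

  private
    a : ℕ → ℚ
    a = seq α

    K : ℚ
    K = ι k

    1⟶ : 1ℝ ⟶ λ _ → 1ℚ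
    1⟶ = ⟶-resp (λ _ → ι1≡1) (fromℕ-⟶ 1)

    kα⟶ : k · α ⟶ λ m → K ⊛ a m
    kα⟶ = ·-⟶ k (seq-⟶ α)

    kα+k⟶ : k · (α +ℝ 1ℝ) ⟶ λ m → K ⊛ (a m ⊕ 1ℚ)
    kα+k⟶ = ·-⟶ k (+-⟶ (seq-⟶ α) 1⟶)

    2kα+k⟶ : k · (2 · α +ℝ 1ℝ) ⟶ λ m → K ⊛ ((1ℚ ⊕ 1ℚ) ⊛ a m ⊕ 1ℚ)
    2kα+k⟶ = ·-⟶ k (+-⟶
      (⟶-resp (λ m → cong (_⊛ a m) (trans (ι-+ 1 1) (cong₂ _⊕_ ι1≡1 ι1≡1)))
        (·-⟶ 2 (seq-⟶ α))) 1⟶)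

    1≲α : (λ _ → ι 1) ≲ a
    1≲α = ≤ℝ⇒≲ (seq-⟶ α) 1≤α

    k≲kα : (λ _ → K) ≲ λ m → K ⊛ a m
    k≲kα = k ℕ.* c , λ m → subst₂ ℚ._≤_
      (trans (cong (K ⊛_) ι1≡1) (*-identityʳ K))
      (trans (solve 4 (λ K a c d → K :* (a :+ c :* d) := K :* a :+ (K :* c) :* d)
                refl K (a m) (ι c) (ε m))
             (cong (λ z → K ⊛ a m ⊕ z ⊛ ε m) (sym (ι-* k c))))
      (⊛-monoʳ-≤ K (ι≥0 k) (proj₂ 1≲α m))
      where
      c : ℕ
      c = proj₁ 1≲α

  ≤k⇒≤kα : ∀ {j} → j ℕ.≤ k → fromℕ j ≤ℝ k · α
  ≤k⇒≤kα j≤k = ≲⇒≤ℝ kα⟶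
    (proj₁ k≲kα , λ m → ℚ.≤-trans (ι-mono j≤k) (proj₂ k≲kα m))

  -- `j + 1 ≤ k + k ≤ kα + k`; the margin is `ε 0`, which equals 1 and is paid for by `1 ≤ k`.
  ≤k⇒<kα+k : ∀ {j} → j ℕ.≤ k → fromℕ j <ℝ k · (α +ℝ 1ℝ)
  ≤k⇒<kα+k {j} j≤k = ⋖⇒<ℝ kα+k⟶ (0 , proj₁ k≲kα , λ m →
    subst (λ z → ι j ⊕ z ℚ.≤ K ⊛ (a m ⊕ 1ℚ) ⊕ ι (proj₁ k≲kα) ⊛ ε m) (sym ε0≡1)
      (linear
        (⊕-mono-≤ (⊕-mono-≤ (ι-mono j≤k) (subst (ℚ._≤ K) ι1≡1 (ι-mono 1≤k)))
                  (proj₂ k≲kα m))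
        (solve 4 (λ K a e j →
           (K :* (a :+ con 1) :+ e) :+ ((j :+ con 1) :+ K) :=
           (j :+ con 1) :+ ((K :+ K) :+ (K :* a :+ e)))
         refl K (a m) (ι (proj₁ k≲kα) ⊛ ε m) (ι j))))

  <kα+k∧≤kα⇒<2kα+k : ∀ {i j} → fromℕ i <ℝ k · (α +ℝ 1ℝ) → fromℕ j ≤ℝ k · α →
                     fromℕ (i ℕ.+ j) <ℝ k · (2 · α +ℝ 1ℝ)
  <kα+k∧≤kα⇒<2kα+k {i} {j} i< j≤ = ⋖⇒<ℝ 2kα+k⟶ (combine′ (<ℝ⇒⋖ kα+k⟶ i<) (≤ℝ⇒≲ kα⟶ j≤))
    where
    combine′ : i ⋖ (λ m → K ⊛ (a m ⊕ 1ℚ)) → (λ _ → ι j) ≲ (λ m → K ⊛ a m) →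
               (i ℕ.+ j) ⋖ λ m → K ⊛ ((1ℚ ⊕ 1ℚ) ⊛ a m ⊕ 1ℚ)
    combine′ (N , c , h) (c′ , h′) = N , c ℕ.+ c′ , λ m →
      subst₂ (λ p e → p ⊕ ε N ℚ.≤ K ⊛ ((1ℚ ⊕ 1ℚ) ⊛ a m ⊕ 1ℚ) ⊕ e)
        (sym (ι-+ i j)) (sym (ι-⊕-⊛ c c′ (ε m)))
        (linear (⊕-mono-≤ (h m) (h′ m)) (solve 7 (λ i j K a e e′ D →
           (K :* ((con 1 :+ con 1) :* a :+ con 1) :+ (e :+ e′)) :+ ((i :+ D) :+ j) :=
           ((i :+ j) :+ D) :+ ((K :* (a :+ con 1) :+ e) :+ (K :* a :+ e′)))
         refl (ι i) (ι j) K (a m) (ι c ⊛ ε m) (ι c′ ⊛ ε m) (ε N)))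

  ≤k⇒<2kα+k : ∀ {j} → j ℕ.≤ k → fromℕ j <ℝ k · (2 · α +ℝ 1ℝ)
  ≤k⇒<2kα+k {j} j≤k = <ℝ-downward {j} {j ℕ.+ 0} {k · (2 · α +ℝ 1ℝ)} (ℕ.m≤m+n j 0)
    (<kα+k∧≤kα⇒<2kα+k {j} {0} (≤k⇒<kα+k j≤k) (≤k⇒≤kα ℕ.z≤n))

  -- Doubled, the claim reads `2i + 2j ≤ w + 2k < (kα + k) + (k + kα)`. This is how half of `W`
  -- together with a clique of at most `k` vertices stays within the bound.
  half+k<kα+k : ∀ {w i j} → fromℕ w <ℝ k · (α +ℝ 1ℝ) → i ℕ.+ i ℕ.≤ w → j ℕ.≤ k →
                fromℕ (i ℕ.+ j) <ℝ k · (α +ℝ 1ℝ)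
  half+k<kα+k {w} {i} {j} w< 2i≤w j≤k = ⋖⇒<ℝ kα+k⟶ (halve (<ℝ⇒⋖ kα+k⟶ w<) k≲kα)
    where
    ι⊛ε≥0 : ∀ c m → 0ℚ ℚ.≤ ι c ⊛ ε m
    ι⊛ε≥0 c m = subst (ℚ._≤ ι c ⊛ ε m) (zeroʳ (ι c)) (⊛-monoʳ-≤ (ι c) (ι≥0 c) (ℚ.<⇒≤ (ε>0 m)))

    halve : w ⋖ (λ m → K ⊛ (a m ⊕ 1ℚ)) → (λ _ → K) ≲ (λ m → K ⊛ a m) →
            (i ℕ.+ j) ⋖ λ m → K ⊛ (a m ⊕ 1ℚ)
    -- Halving the inequality halves its margin to `ε (double N)`. The doubled right side contains
    -- each error twice; the second copies come from their nonnegativity.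
    halve (N , c , h) (c′ , h′) = double N , c ℕ.+ c′ , λ m →
      subst₂ (λ p e → p ⊕ ε (double N) ℚ.≤ K ⊛ (a m ⊕ 1ℚ) ⊕ e)
        (sym (ι-+ i j)) (sym (ι-⊕-⊛ c c′ (ε m)))
        (≤-double⁻¹ (linear
          (⊕-mono-≤
            (⊕-mono-≤ (subst (ℚ._≤ ι w) (ι-+ i i) (ι-mono 2i≤w))
                      (⊕-mono-≤ (ι-mono j≤k) (ι-mono j≤k)))
            (⊕-mono-≤ (⊕-mono-≤ (ι⊛ε≥0 c m) (ι⊛ε≥0 c′ m))
                      (⊕-mono-≤ (subst (λ z → ι w ⊕ z ℚ.≤ K ⊛ (a m ⊕ 1ℚ) ⊕ ι c ⊛ ε m)
                                   (sym (ε-halves N)) (h m))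
                                (h′ m))))
          (solve 8 (λ i j w K a e e′ D →
             let p = (i :+ j) :+ D
                 q = K :* (a :+ con 1) :+ (e :+ e′)
             in (q :+ q) :+ (((i :+ i) :+ (j :+ j)) :+
                             ((con 0 :+ con 0) :+ ((w :+ (D :+ D)) :+ K))) :=
                (p :+ p) :+ ((w :+ (K :+ K)) :+
                             ((e :+ e′) :+ ((K :* (a :+ con 1) :+ e) :+ (K :* a :+ e′)))))
            refl (ι i) (ι j) (ι w) K (a m) (ι c ⊛ ε m) (ι c′ ⊛ ε m) (ε (double N)))))

-- Cycles, chordal graphs and clique sums

module _ {n : ℕ} {P : Pred (Fin n) 0ℓ} (P? : Decidable P) where

  opaque
    select : Subset n
    select = tabulate (does ∘ P?)

    ∈-select⁺ : ∀ {v} → P v → v ∈ select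
    ∈-select⁺ {v} Pv = lookup⇒[]= v select
      (trans (lookup∘tabulate (does ∘ P?) v) (dec-true (P? v) Pv))

    ∈-select⁻ : ∀ {v} → v ∈ select → P v
    ∈-select⁻ {v} v∈ with P? v | trans (sym (lookup∘tabulate (does ∘ P?) v)) ([]=⇒lookup v∈)
    ... | yes Pv | _ = Pv

-- Arithmetic of positions on a cycle

toℕ-cyclicSuc : ∀ {m} (i : Fin (suc m)) → toℕ (cyclicSuc i) ≡ suc (toℕ i) % suc m
toℕ-cyclicSuc {m} i = toℕ-fromℕ< (m%n<n (suc (toℕ i)) (suc m))

cyclicSuc-surjective : ∀ {m} (i : Fin (suc m)) → ∃[ p ] cyclicSuc p ≡ i
cyclicSuc-surjective {m} zero = fromℕᶠ m , toℕ-injective (begin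
  toℕ (cyclicSuc (fromℕᶠ m))    ≡⟨ toℕ-cyclicSuc (fromℕᶠ m) ⟩
  suc (toℕ (fromℕᶠ m)) % suc m  ≡⟨ cong (λ t → suc t % suc m) (toℕ-fromℕ m) ⟩
  suc m % suc m                ≡⟨ n%n≡0 (suc m) ⟩
  0                            ∎)
  where open ≡-Reasoning
cyclicSuc-surjective {suc m} (suc i) = inject₁ i , toℕ-injective (begin
  toℕ (cyclicSuc (inject₁ i))            ≡⟨ toℕ-cyclicSuc (inject₁ i) ⟩
  suc (toℕ (inject₁ i)) % suc (suc m)    ≡⟨ cong (λ t → suc t % suc (suc m)) (toℕ-inject₁ i) ⟩
  suc (toℕ i) % suc (suc m)              ≡⟨ m<n⇒m%n≡m (s≤s (toℕ<n i)) ⟩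
  suc (toℕ i)                            ∎)
  where open ≡-Reasoning

rotate : ∀ {m} → ℕ → Fin m → Fin m
rotate zero    i = i
rotate (suc j) i = cyclicSuc (rotate j i)

toℕ-rotate : ∀ {m} j (i : Fin (suc m)) → toℕ (rotate j i) ≡ (j + toℕ i) % suc m
toℕ-rotate {m} zero    i = sym (m<n⇒m%n≡m (toℕ<n i))
toℕ-rotate {m} (suc j) i = begin
  toℕ (cyclicSuc (rotate j i))            ≡⟨ toℕ-cyclicSuc (rotate j i) ⟩
  suc (toℕ (rotate j i)) % suc m          ≡⟨ cong (λ t → suc t % suc m) (toℕ-rotate j i) ⟩
  (1 + t % suc m) % suc m                 ≡⟨ %-distribˡ-+ 1 (t % suc m) (suc m) ⟩
  (1 % suc m + t % suc m % suc m) % suc m ≡⟨ cong (λ r → (1 % suc m + r) % suc m) (m%n%n≡m%n t (suc m)) ⟩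
  (1 % suc m + t % suc m) % suc m         ≡⟨ %-distribˡ-+ 1 t (suc m) ⟨
  suc t % suc m                           ∎
  where
  open ≡-Reasoning
  t = j + toℕ i

-- Since `j + toℕ i` is below twice the length, reduction subtracts the length at most once;
-- returning to `i` would then force `j` to be 0 or the full length.
rotate-free : ∀ {m} j (i : Fin m) → 0 < j → j < m → rotate j i ≢ i
rotate-free {suc m} j i 0<j j<m eq with ℕ.<-≤-connex (j + toℕ i) (suc m)
... | inj₁ small = ℕ.<-irrefl (sym j≡0) 0<j
  where
  j≡0 : j ≡ 0
  j≡0 = ℕ.+-cancelʳ-≡ (toℕ i) j 0
    (trans (sym (m<n⇒m%n≡m small)) (trans (sym (toℕ-rotate j i)) (cong toℕ eq)))
... | inj₂ large with ℕ.m≤n⇒∃[o]m+o≡n large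
... | r , M+r≡ = ℕ.<-irrefl j≡M j<m
  where
  r<M : r < suc m
  r<M = ℕ.+-cancelˡ-< (suc m) r (suc m)
    (subst (_< suc m + suc m) (sym M+r≡) (ℕ.+-mono-< j<m (toℕ<n i)))
  r≡i : r ≡ toℕ i
  r≡i = begin
    r                      ≡⟨ m<n⇒m%n≡m r<M ⟨
    r % suc m              ≡⟨ [m+n]%n≡m%n r (suc m) ⟨
    (r + suc m) % suc m    ≡⟨ cong (_% suc m) (trans (ℕ.+-comm r (suc m)) M+r≡) ⟩
    (j + toℕ i) % suc m    ≡⟨ toℕ-rotate j i ⟨
    toℕ (rotate j i)       ≡⟨ cong toℕ eq ⟩
    toℕ i                  ∎
    where open ≡-Reasoning
  j≡M : j ≡ suc m
  j≡M = ℕ.+-cancelʳ-≡ (toℕ i) j (suc m) (trans (sym M+r≡) (cong (suc m +_) r≡i))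

module _ {n : ℕ} {V : Subset n} (G : Graph V) where

  Simplicial : Subset n → Fin n → Set
  Simplicial S v = ∀ {u w} → u ∈ S → w ∈ S → Adj G v u → Adj G v w → u ≢ w → Adj G u w

  HereditarilySimplicial : Set
  HereditarilySimplicial = ∀ S → S ⊆ V → Nonempty S → ∃[ v ] v ∈ S × Simplicial S v

  -- The form of Dirac's theorem on chordal graphs that glues along cliques.
  Dirac : Set
  Dirac = ∀ {S K} → S ⊆ V → IsClique G K → (∃[ s ] s ∈ S × s ∉ K) →
          ∃[ v ] v ∈ S × v ∉ K × Simplicial S v

  dirac⇒hereditarilySimplicial : Dirac → HereditarilySimplicial
  dirac⇒hereditarilySimplicial dirac S S⊆V (s , s∈S)
    with dirac S⊆V ((λ v∈⊥ → contradiction v∈⊥ ∉⊥) , λ v∈⊥ → contradiction v∈⊥ ∉⊥) (s , s∈S , ∉⊥)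
  ... | v , v∈S , _ , simplicial = v , v∈S , simplicial

  -- Among the vertices of a cycle some vertex is simplicial, and its two neighbours on the cycle
  -- are joined by a chord.
  hereditarilySimplicial⇒chordal : HereditarilySimplicial → Chordal G
  hereditarilySimplicial⇒chordal hs {suc m} c 3<m (c-inj , edge) =
    let on-cycle? = λ v → any? (λ i → c i Fin.≟ v)
        S = select on-cycle?
        on-cycle : ∀ i → c i ∈ S
        on-cycle i = ∈-select⁺ on-cycle? (i , refl)
        v , v∈S , simplicial = hs S
          (λ u∈S → case ∈-select⁻ on-cycle? u∈S of λ { (i , refl) → proj₁ (within G (edge i)) })
          (c zero , on-cycle zero)
        i , ci≡v = ∈-select⁻ on-cycle? v∈S
        p , σp≡i = cyclicSuc-surjective i
        cσp≡v = trans (cong c σp≡i) ci≡v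
    -- The simplicial vertex sits at position `rotate 1 p`. That the chord is not a cycle edge at
    -- its other end, `rotate 3 p ≢ p`, requires the length to exceed 3.
    in p , rotate 2 p ,
       rotate-free 1 (rotate 1 p) (s≤s z≤n) (ℕ.<-trans (s≤s (s≤s z≤n)) 3<m) ,
       rotate-free 3 p (s≤s z≤n) 3<m ∘ sym ,
       simplicial (on-cycle p) (on-cycle (rotate 2 p))
         (subst (λ x → Adj G x (c p)) cσp≡v (adj-sym G (edge p)))
         (subst (λ x → Adj G x (c (rotate 2 p))) cσp≡v (edge (rotate 1 p)))
         (rotate-free 2 p (s≤s z≤n) (ℕ.<-trans (s≤s (s≤s (s≤s z≤n))) 3<m) ∘ sym ∘ c-inj)

  clique-⊆ : ∀ {K L} → L ⊆ K → IsClique G K → IsClique G L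
  clique-⊆ L⊆K (K⊆V , adj) = K⊆V ∘ L⊆K , λ u∈ v∈ → adj (L⊆K u∈) (L⊆K v∈)

-- Gluing graphs along cliques

module _ {n : ℕ} where

  -- R is the union of P and Q, which overlap in a clique of both.
  record CliqueSum {U V S : Subset n} (P : Graph U) (Q : Graph V) (R : Graph S) : Set where
    field
      cover    : ∀ {v} → v ∈ S → v ∈ U ⊎ v ∈ V
      split    : ∀ {u v} → Adj R u v → Adj P u v ⊎ Adj Q u v
      P⊆R      : ∀ {u v} → Adj P u v → Adj R u v
      Q⊆R      : ∀ {u v} → Adj Q u v → Adj R u v
      P-clique : IsClique P (U ∩ V)
      Q-clique : IsClique Q (U ∩ V)

  module _ {U V S : Subset n} {P : Graph U} {Q : Graph V} {R : Graph S} where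

    CliqueSum-sym : CliqueSum P Q R → CliqueSum Q P R
    CliqueSum-sym g = record
      { cover    = Sum.swap ∘ cover
      ; split    = Sum.swap ∘ split
      ; P⊆R      = Q⊆R
      ; Q⊆R      = P⊆R
      ; P-clique = clique-⊆ Q ∩-swap Q-clique
      ; Q-clique = clique-⊆ P ∩-swap P-clique
      }
      where
      open CliqueSum g
      ∩-swap : V ∩ U ⊆ U ∩ V
      ∩-swap = x∈p∩q⁺ ∘ swap ∘ x∈p∩q⁻ V U

    module _ (g : CliqueSum P Q R) where
      open CliqueSum g

      -- An edge of `Q` with both ends in `U` lies in the overlap, which is also a clique of `P`.
      adj-left : ∀ {u v} → u ∈ U → v ∈ U → Adj R u v → Adj P u v
      adj-left u∈U v∈U e with split e
      ... | inj₁ eP = eP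
      ... | inj₂ eQ = let (u∈V , v∈V) = within Q eQ in
        proj₂ P-clique (x∈p∩q⁺ (u∈U , u∈V)) (x∈p∩q⁺ (v∈U , v∈V)) (λ eq → irrefl R eq e)

      clique-left : ∀ {K} → K ⊆ U → IsClique R K → IsClique P K
      clique-left K⊆U (_ , adj) =
        K⊆U , λ u∈ v∈ u≢v → adj-left (K⊆U u∈) (K⊆U v∈) (adj u∈ v∈ u≢v)

  module _ {U V S : Subset n} {P : Graph U} {Q : Graph V} {R : Graph S} where

    -- If the clique has a vertex `w` outside `U`, all edges at `w` belong to `Q` and pull the other
    -- vertices into `V`.
    clique-split : CliqueSum P Q R → ∀ {K} → IsClique R K → IsClique P K ⊎ IsClique Q K
    clique-split g {K} K-clique@(K⊆S , adj) with any? (λ v → (v ∈? K) ×-dec ¬? (v ∈? U))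
    ... | no K⊈U = inj₁ (clique-left g
            (λ {v} v∈K → decidable-stable (v ∈? U) λ v∉U → K⊈U (v , v∈K , v∉U)) K-clique)
    ... | yes (w , w∈K , w∉U) = inj₂ (clique-left (CliqueSum-sym g) K⊆V K-clique)
      where
      open CliqueSum g
      K⊆V : K ⊆ V
      K⊆V {v} v∈K with v Fin.≟ w
      ... | yes refl = [ (λ v∈U → contradiction v∈U w∉U) , id ]′ (cover (K⊆S v∈K))
      ... | no v≢w = [ (λ e → contradiction (proj₂ (within P e)) w∉U) , proj₁ ∘ within Q ]′
                       (split (adj v∈K w∈K v≢w))

    -- For `T` inside `U` this is the property of `P`. Otherwise the property of `Q`, applied to
    -- `T ∩ V` and the overlap, yields a vertex outside `U`: it avoids `K`, and all its neighbours
    -- in `R` come from `Q`, so it remains simplicial in all of `T`.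
    dirac-left : CliqueSum P Q R → Dirac P → Dirac Q → ∀ {T K} → T ⊆ S → IsClique P K →
                 (∃[ t ] t ∈ T × t ∉ K) → ∃[ v ] v ∈ T × v ∉ K × Simplicial R T v
    dirac-left g diracP diracQ {T} {K} T⊆S K-clique t
      with any? (λ v → (v ∈? T) ×-dec ¬? (v ∈? U))
    ... | no T⊈U = v , v∈T , v∉K , λ u∈T w∈T vu vw u≢w → P⊆R (simplicial u∈T w∈T
            (adj-left g (T⊆U v∈T) (T⊆U u∈T) vu) (adj-left g (T⊆U v∈T) (T⊆U w∈T) vw) u≢w)
      where
      open CliqueSum g
      T⊆U : T ⊆ U
      T⊆U {v} v∈T = decidable-stable (v ∈? U) λ v∉U → T⊈U (v , v∈T , v∉U)
      found = diracP T⊆U K-clique t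
      v = proj₁ found
      v∈T = proj₁ (proj₂ found)
      v∉K = proj₁ (proj₂ (proj₂ found))
      simplicial = proj₂ (proj₂ (proj₂ found))
    ... | yes (s , s∈T , s∉U) = v , v∈T , v∉U ∘ proj₁ K-clique , λ u∈T w∈T vu vw u≢w →
            Q⊆R (simplicial (x∈p∩q⁺ (u∈T , proj₂ (within Q (adjQ vu))))
                            (x∈p∩q⁺ (w∈T , proj₂ (within Q (adjQ vw))))
                            (adjQ vu) (adjQ vw) u≢w)
      where
      open CliqueSum g
      s∈V : s ∈ V
      s∈V = [ (λ s∈U → contradiction s∈U s∉U) , id ]′ (cover (T⊆S s∈T))
      found = diracQ {T ∩ V} (proj₂ ∘ x∈p∩q⁻ T V) Q-clique
        (s , x∈p∩q⁺ (s∈T , s∈V) , s∉U ∘ proj₁ ∘ x∈p∩q⁻ U V)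
      v = proj₁ found
      v∈T = proj₁ (x∈p∩q⁻ T V (proj₁ (proj₂ found)))
      v∈V = proj₂ (x∈p∩q⁻ T V (proj₁ (proj₂ found)))
      v∉U : v ∉ U
      v∉U v∈U = proj₁ (proj₂ (proj₂ found)) (x∈p∩q⁺ (v∈U , v∈V))
      simplicial = proj₂ (proj₂ (proj₂ found))
      adjQ : ∀ {u} → Adj R v u → Adj Q v u
      adjQ e = [ (λ eP → contradiction (proj₁ (within P eP)) v∉U) , id ]′ (split e)

  dirac-sum : ∀ {U V S : Subset n} {P : Graph U} {Q : Graph V} {R : Graph S} →
              CliqueSum P Q R → Dirac P → Dirac Q → Dirac R
  dirac-sum g diracP diracQ T⊆S K-clique t with clique-split g K-clique
  ... | inj₁ P-clique = dirac-left g diracP diracQ T⊆S P-clique t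
  ... | inj₂ Q-clique = dirac-left (CliqueSum-sym g) diracQ diracP T⊆S Q-clique t

  infixr 6 _∪ᴳ_

  _∪ᴳ_ : {U V : Subset n} → Graph U → Graph V → Graph (U ∪ V)
  P ∪ᴳ Q = record
    { Adj     = λ u v → Adj P u v ⊎ Adj Q u v
    ; adj?    = λ u v → adj? P u v ⊎-dec adj? Q u v
    ; adj-sym = Sum.map (adj-sym P) (adj-sym Q)
    ; irrefl  = λ eq → [ irrefl P eq , irrefl Q eq ]′
    ; within  = [ (λ e → let (u∈ , v∈) = within P e in x∈p∪q⁺ (inj₁ u∈) , x∈p∪q⁺ (inj₁ v∈))
                , (λ e → let (u∈ , v∈) = within Q e in x∈p∪q⁺ (inj₂ u∈) , x∈p∪q⁺ (inj₂ v∈)) ]′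
    }

  cliqueSum-∪ᴳ : {U V : Subset n} {P : Graph U} {Q : Graph V} →
                 IsClique P (U ∩ V) → IsClique Q (U ∩ V) → CliqueSum P Q (P ∪ᴳ Q)
  cliqueSum-∪ᴳ {U} {V} P-clique Q-clique = record
    { cover    = x∈p∪q⁻ U V
    ; split    = id
    ; P⊆R      = inj₁
    ; Q⊆R      = inj₂
    ; P-clique = P-clique
    ; Q-clique = Q-clique
    }

  module _ {U V : Subset n} {P : Graph U} {R : Graph V} (V⊆U : V ⊆ U)
           (P⊆R : ∀ {u v} → Adj P u v → Adj R u v)
           (R⊆P : ∀ {u v} → Adj R u v → Adj P u v) where

    clique-resp : ∀ {K} → IsClique R K → IsClique P K
    clique-resp (K⊆V , adj) = V⊆U ∘ K⊆V , λ u∈ v∈ u≢v → R⊆P (adj u∈ v∈ u≢v)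

    dirac-resp : Dirac P → Dirac R
    dirac-resp dirac S⊆V K-clique s with dirac (V⊆U ∘ S⊆V) (clique-resp K-clique) s
    ... | v , v∈S , v∉K , simplicial = v , v∈S , v∉K , λ u∈ w∈ vu vw u≢w →
      P⊆R (simplicial u∈ w∈ (R⊆P vu) (R⊆P vw) u≢w)

  dirac-complete : (S : Subset n) → Dirac (complete S)
  dirac-complete S T⊆S _ (t , t∈T , t∉K) =
    t , t∈T , t∉K , λ u∈ w∈ _ _ u≢w → u≢w , T⊆S u∈ , T⊆S w∈

  clique-complete : (S : Subset n) → IsClique (complete S) S
  clique-complete S = id , λ u∈ v∈ u≢v → u≢v , u∈ , v∈

  dirac-[] : {V S : Subset n} (G : Graph V) → S ⊆ V → Dirac G → Dirac (G [ S ])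
  dirac-[] G S⊆V dirac T⊆S (K⊆S , adj) t
    with dirac (S⊆V ∘ T⊆S) (S⊆V ∘ K⊆S , λ u∈ v∈ u≢v → proj₁ (adj u∈ v∈ u≢v)) t
  ... | v , v∈T , v∉K , simplicial = v , v∈T , v∉K , λ u∈ w∈ (vu , _) (vw , _) u≢w →
    simplicial u∈ w∈ vu vw u≢w , T⊆S u∈ , T⊆S w∈

-- Dirac's theorem

prepend : ∀ {A : Set} → A → (ℕ → A) → ℕ → A
prepend a p zero    = a
prepend a p (suc t) = p t

-- The walk with positions `i + 1` to `i + d` cut out.
splice : ∀ {A : Set} (i d : ℕ) → (ℕ → A) → ℕ → A
splice i d p t with t ℕ.≤? i
... | yes _ = p t
... | no  _ = p (t + d)

splice-≤ : ∀ {A : Set} i d (p : ℕ → A) {t} → t ≤ i → splice i d p t ≡ p t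
splice-≤ i d p {t} t≤i with t ℕ.≤? i
... | yes _ = refl
... | no t≰i = contradiction t≤i t≰i

splice-> : ∀ {A : Set} i d (p : ℕ → A) {t} → i < t → splice i d p t ≡ p (t + d)
splice-> i d p {t} i<t with t ℕ.≤? i
... | yes t≤i = contradiction t≤i (ℕ.<⇒≱ i<t)
... | no _ = refl

module _ {n : ℕ} {V : Subset n} (G : Graph V) where

  Far : Fin n → Fin n → Set
  Far z v = v ≢ z × ¬ Adj G z v

  far? : ∀ z v → Dec (Far z v)
  far? z v = ¬? (v Fin.≟ z) ×-dec ¬? (adj? G z v)

  -- A walk, possibly with repetitions, whose interior avoids `z` and the neighbours of `z`. Values
  -- of `p` beyond `l` are irrelevant.
  record Arc (z x y : Fin n) (l : ℕ) (p : ℕ → Fin n) : Set where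
    field
      start : p 0 ≡ x
      end   : p l ≡ y
      step  : ∀ {t} → t < l → Adj G (p t) (p (suc t))
      far   : ∀ {t} → 0 < t → t < l → Far z (p t)

  splice-arc : ∀ {z x y l i d p} → Arc z x y (l + d) p → i < l →
               Adj G (p i) (p (suc i + d)) → Arc z x y l (splice i d p)
  splice-arc {z} {l = l} {i} {d} {p} arc i<l chord = record
    { start = trans (splice-≤ i d p z≤n) start
    ; end   = trans (splice-> i d p i<l) end
    ; step  = step′
    ; far   = far′
    }
    where
    open Arc arc
    q = splice i d p
    step′ : ∀ {t} → t < l → Adj G (q t) (q (suc t))
    step′ {t} t<l with ℕ.<-cmp t i
    ... | tri< t<i _ _ = subst₂ (Adj G) (sym (splice-≤ i d p (ℕ.<⇒≤ t<i))) (sym (splice-≤ i d p t<i))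
                           (step (ℕ.<-≤-trans t<l (ℕ.m≤m+n l d)))
    ... | tri≈ _ refl _ = subst₂ (Adj G) (sym (splice-≤ i d p ℕ.≤-refl)) (sym (splice-> i d p ℕ.≤-refl)) chord
    ... | tri> _ _ i<t = subst₂ (Adj G) (sym (splice-> i d p i<t)) (sym (splice-> i d p (ℕ.m<n⇒m<1+n i<t)))
                           (step (ℕ.+-monoˡ-< d t<l))
    far′ : ∀ {t} → 0 < t → t < l → Far z (q t)
    far′ {t} 0<t t<l with ℕ.≤-<-connex t i
    ... | inj₁ t≤i = subst (Far z) (sym (splice-≤ i d p t≤i)) (far 0<t (ℕ.<-≤-trans t<l (ℕ.m≤m+n l d)))
    ... | inj₂ i<t = subst (Far z) (sym (splice-> i d p i<t))
                       (far (ℕ.<-≤-trans 0<t (ℕ.m≤m+n t d)) (ℕ.+-monoˡ-< d t<l))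

  -- A chord of the cycle through z closed by a shortest arc would shorten the arc.
  module _ (chordal : Chordal G) {z x y : Fin n} (x≢y : x ≢ y) (x≁y : ¬ Adj G x y)
           (zx : Adj G z x) (zy : Adj G z y) where

    no-arc : ∀ {l} → Acc _<_ l → ∀ {p} → ¬ Arc z x y l p
    no-arc {l} (acc rs) {p} arc =
      let (i , j , j≢σi , i≢σj , chord) = chordal c 3<m
            ( (λ {i} {j} eq → toℕ-injective (cyc-injective (toℕ<n i) (toℕ<n j) eq))
            , λ i → edge (toℕ i) (toℕ<n i) (toℕ-cyclicSuc i))
      in no-chord (toℕ<n i) (toℕ<n j)
           (λ eq → j≢σi (toℕ-injective (trans eq (sym (toℕ-cyclicSuc i)))))
           (λ eq → i≢σj (toℕ-injective (trans eq (sym (toℕ-cyclicSuc j)))))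
           chord
      where
      open Arc arc

      m : ℕ
      -- The cycle consists of `z` and the `l + 1` vertices of the arc.
      m = suc (suc l)

      shortcut : ∀ {i j} → suc i < j → j ≤ l → ¬ Adj G (p i) (p j)
      shortcut {i} {j} i+1<j j≤l chord with ℕ.m≤n⇒∃[o]m+o≡n i+1<j | ℕ.m≤n⇒∃[o]m+o≡n j≤l
      ... | o , refl | o′ , refl = no-arc
        (rs (ℕ.<-≤-trans (ℕ.m<m+n (suc i + o′) (s≤s z≤n)) (ℕ.≤-reflexive eq)))
        (splice-arc {d = suc o} (subst (λ l → Arc z x y l p) (sym eq) arc)
          (s≤s (ℕ.m≤m+n i o′))
          (subst (λ t → Adj G (p i) (p t)) (cong suc (sym (ℕ.+-suc i o))) chord))
        where
        eq : suc i + o′ + suc o ≡ suc (suc i) + o + o′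
        eq = trans (ℕ.+-suc (suc i + o′) o) (cong (λ t → suc (suc t))
          (trans (ℕ.+-assoc i o′ o) (trans (cong (i +_) (ℕ.+-comm o′ o)) (sym (ℕ.+-assoc i o o′)))))

      -- A repetition lets `p i` step directly to `p (suc j)`, or, when `j` is the last position,
      -- lets the predecessor of the first occurrence step directly to the end; both are shortcuts.
      no-repeat : ∀ {i j} → i < j → j ≤ l → p i ≢ p j
      no-repeat {i} {j} i<j j≤l eq with ℕ.m≤n⇒m<n∨m≡n j≤l
      ... | inj₁ j<l = shortcut (s≤s i<j) j<l
                         (subst (λ v → Adj G v (p (suc j))) (sym eq) (step j<l))
      no-repeat {zero}  _   _ eq | inj₂ refl = x≢y (trans (sym start) (trans eq end))
      no-repeat {suc i} i<j _ eq | inj₂ refl =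
        shortcut i<j ℕ.≤-refl (subst (Adj G (p i)) eq (step (ℕ.<-trans (ℕ.n<1+n i) i<j)))

      0<l : 0 < l
      0<l = ℕ.n≢0⇒n>0 λ { refl → x≢y (trans (sym start) end) }

      1<l : 1 < l
      1<l = ℕ.≤∧≢⇒< 0<l λ { refl → x≁y (subst₂ (Adj G) start end (step (s≤s z≤n))) }

      3<m : 3 < m
      3<m = s≤s (s≤s 1<l)

      z-neighbours : ∀ {t} → t ≤ l → Adj G z (p t) → t ≡ 0 ⊎ t ≡ l
      z-neighbours {zero}  _   _ = inj₁ refl
      z-neighbours {suc t} t≤l e with ℕ.m≤n⇒m<n∨m≡n t≤l
      ... | inj₁ t<l = contradiction e (proj₂ (far (s≤s z≤n) t<l))
      ... | inj₂ eq  = inj₂ eq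

      z∉arc : ∀ {t} → t ≤ l → z ≢ p t
      z∉arc {zero}  _   eq = irrefl G (trans eq start) zx
      z∉arc {suc t} t≤l eq with ℕ.m≤n⇒m<n∨m≡n t≤l
      ... | inj₁ t<l  = proj₁ (far (s≤s z≤n) t<l) (sym eq)
      ... | inj₂ refl = irrefl G (trans eq end) zy

      cyc : ℕ → Fin n
      cyc zero    = z
      cyc (suc t) = p t

      c : Fin m → Fin n
      c i = cyc (toℕ i)

      cyc-injective : ∀ {s t} → s < m → t < m → cyc s ≡ cyc t → s ≡ t
      cyc-injective {zero}  {zero}  _ _ _ = refl
      cyc-injective {zero}  {suc t} _ (s≤s (s≤s t≤l)) eq = contradiction eq (z∉arc t≤l)
      cyc-injective {suc s} {zero}  (s≤s (s≤s s≤l)) _ eq = contradiction (sym eq) (z∉arc s≤l)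
      cyc-injective {suc s} {suc t} (s≤s (s≤s s≤l)) (s≤s (s≤s t≤l)) eq with ℕ.<-cmp s t
      ... | tri< s<t _ _  = contradiction eq (no-repeat s<t t≤l)
      ... | tri≈ _ refl _ = refl
      ... | tri> _ _ t<s  = contradiction (sym eq) (no-repeat t<s s≤l)

      edge : ∀ s → s < m → ∀ {t} → t ≡ suc s % m → Adj G (cyc s) (cyc t)
      edge zero _ refl = subst (Adj G z) (sym start) zx
      edge (suc s) (s≤s (s≤s s≤l)) refl with ℕ.m≤n⇒m<n∨m≡n s≤l
      ... | inj₁ s<l  = subst (λ t → Adj G (p s) (cyc t))
                          (sym (m<n⇒m%n≡m (s≤s (s≤s s<l)))) (step s<l)
      ... | inj₂ refl = subst₂ (λ v t → Adj G v (cyc t)) (sym end) (sym (n%n≡0 m)) (adj-sym G zy)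

      -- A chord at `z` would end at `x` or `y`, which are next to `z` on the cycle; a chord between
      -- two arc vertices is a shortcut.
      no-chord : ∀ {s t} → s < m → t < m → t ≢ suc s % m → s ≢ suc t % m → ¬ Adj G (cyc s) (cyc t)
      no-chord {zero}  {zero}  _ _ _ _ e = irrefl G refl e
      no-chord {zero}  {suc t} _ (s≤s (s≤s t≤l)) t≢ s≢ e with z-neighbours t≤l e
      ... | inj₁ refl = t≢ refl
      ... | inj₂ refl = s≢ (sym (n%n≡0 m))
      no-chord {suc s} {zero}  (s≤s (s≤s s≤l)) _ t≢ s≢ e with z-neighbours s≤l (adj-sym G e)
      ... | inj₁ refl = s≢ refl
      ... | inj₂ refl = t≢ (sym (n%n≡0 m))
      no-chord {suc s} {suc t} s<m@(s≤s (s≤s s≤l)) t<m@(s≤s (s≤s t≤l)) t≢ s≢ e with ℕ.<-cmp s t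
      ... | tri< s<t _ _  = shortcut (ℕ.≤∧≢⇒< s<t λ { refl → t≢ (sym (m<n⇒m%n≡m t<m)) }) t≤l e
      ... | tri≈ _ refl _ = irrefl G refl e
      ... | tri> _ _ t<s  = shortcut (ℕ.≤∧≢⇒< t<s λ { refl → s≢ (sym (m<n⇒m%n≡m s<m)) }) s≤l (adj-sym G e)

    -- Prefixed by `x` and followed by `y`, a walk inside `T` is an arc, which `no-arc` excludes.
    no-detour : ∀ {T u w} → (∀ {v} → v ∈ T → Far z v) → u ∈ T → Star (Adj (G [ T ])) u w →
                w ∈ T → Adj G x u → ¬ Adj G w y
    no-detour {T} T-far u∈T walk w∈T xu wy with tail u∈T walk w∈T wy
      where
      Tail : Fin n → Set
      Tail u = ∃[ l ] ∃[ p ] p 0 ≡ u × p l ≡ y × (∀ {t} → t < l → Adj G (p t) (p (suc t)))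
                     × (∀ {t} → t < l → Far z (p t))
      tail : ∀ {u w} → u ∈ T → Star (Adj (G [ T ])) u w → w ∈ T → Adj G w y → Tail u
      tail {u} u∈T Star.ε _ uy = 1 , prepend u (λ _ → y) , refl , refl ,
        (λ { (s≤s z≤n) → uy }) , (λ { (s≤s z≤n) → T-far u∈T })
      tail {u} u∈T ((uv , _ , v∈T) ◅ walk) w∈T wy with tail v∈T walk w∈T wy
      ... | l , p , p0≡v , pl≡y , step , far = suc l , prepend u p , refl , pl≡y ,
        (λ { {zero}  _         → subst (Adj G u) (sym p0≡v) uv
           ; {suc t} (s≤s t<l) → step t<l }) ,
        (λ { {zero}  _         → T-far u∈T
           ; {suc t} (s≤s t<l) → far t<l })
    ... | l , p , p0≡u , pl≡y , step , far = no-arc (<-wellFounded (suc l)) {prepend x p} record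
      { start = refl
      ; end   = pl≡y
      ; step  = λ { {zero}  _         → subst (Adj G x) (sym p0≡u) xu
                  ; {suc t} (s≤s t<l) → step t<l }
      ; far   = λ { {suc t} _ (s≤s t<l) → far t<l }
      }
  record Component (T : Subset n) (a : Fin n) : Set where
    field
      C         : Subset n
      a∈C       : a ∈ C
      C⊆T       : C ⊆ T
      closed    : ∀ {u w} → u ∈ C → w ∈ T → Adj G u w → w ∈ C
      connected : ∀ {u} → u ∈ C → Star (Adj (G [ T ])) a u

  opaque
    -- The set grows from `a` along edges that leave it within `T`; the number of vertices of `T`
    -- not yet reached decreases.
    component : ∀ {T a} → a ∈ T → Component T a
    component {T} {a} a∈T = grow ⁅ a ⁆ (x∈⁅x⁆ a)
      (λ u∈ → subst (_∈ T) (sym (x∈⁅y⁆⇒x≡y a u∈)) a∈T)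
      (λ u∈ → subst (Star _ a) (sym (x∈⁅y⁆⇒x≡y a u∈)) Star.ε)
      (<-wellFounded _)
      where
      rest? : ∀ C v → Dec (v ∈ T × v ∉ C)
      rest? C v = (v ∈? T) ×-dec ¬? (v ∈? C)
      grow : ∀ C → a ∈ C → C ⊆ T → (∀ {u} → u ∈ C → Star (Adj (G [ T ])) a u) →
             Acc _<_ ∣ select (rest? C) ∣ → Component T a
      grow C a∈C C⊆T connected (acc rs)
        with any? (λ u → any? λ w → (u ∈? C) ×-dec (rest? C w ×-dec adj? G u w))
      ... | no stuck = record
        { C = C ; a∈C = a∈C ; C⊆T = C⊆T ; connected = connected
        ; closed = λ {u} {w} u∈C w∈T uw →
            decidable-stable (w ∈? C) λ w∉C → stuck (u , w , u∈C , (w∈T , w∉C) , uw) }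
      ... | yes (u , w , u∈C , (w∈T , w∉C) , uw) = grow (C ∪ ⁅ w ⁆) (x∈p∪q⁺ (inj₁ a∈C))
        ([ C⊆T , (λ v∈ → subst (_∈ T) (sym (x∈⁅y⁆⇒x≡y w v∈)) w∈T) ]′ ∘ x∈p∪q⁻ C ⁅ w ⁆)
        ([ connected
         , (λ v∈ → subst (Star _ a) (sym (x∈⁅y⁆⇒x≡y w v∈))
                     (connected u∈C ◅◅ (uw , C⊆T u∈C , w∈T) ◅ Star.ε)) ]′ ∘ x∈p∪q⁻ C ⁅ w ⁆)
        (rs (p⊂q⇒∣p∣<∣q∣
          ( (λ v∈ → let (v∈T , v∉) = ∈-select⁻ (rest? (C ∪ ⁅ w ⁆)) v∈
                    in ∈-select⁺ (rest? C) (v∈T , v∉ ∘ x∈p∪q⁺ ∘ inj₁))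
          , w , ∈-select⁺ (rest? C) (w∈T , w∉C)
          , λ w∈ → proj₂ (∈-select⁻ (rest? (C ∪ ⁅ w ⁆)) w∈) (x∈p∪q⁺ (inj₂ (x∈⁅x⁆ w))))))

  private
    -- Fixing `S` permits induction on its size; `K` stays arbitrary because the recursive use takes
    -- a neighbourhood as the clique.
    DiracAt : Subset n → Set
    DiracAt S = ∀ {K} → IsClique G K → (∃[ s ] s ∈ S × s ∉ K) →
                ∃[ v ] v ∈ S × v ∉ K × Simplicial G S v

  -- Cut S along the neighbourhood of a component of the vertices far from z.
  far-simplicial : Chordal G → ∀ {S} → S ⊆ V →
    (∀ {S′} → S′ ⊆ V → ∣ S′ ∣ < ∣ S ∣ → DiracAt S′) →
    ∀ {z a} → z ∈ S → a ∈ S → Far z a → ∃[ v ] v ∈ S × Far z v × Simplicial G S v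
  far-simplicial chordal {S} S⊆V ih {z} {a} z∈S a∈S a-far =
    v , T⊆S (C⊆T v∈C) , T-far (C⊆T v∈C) , λ u∈S w∈S vu vw u≢w →
      simplicial (closed-nbhd v∈C u∈S vu) (closed-nbhd v∈C w∈S vw) vu vw u≢w
    where
    T? : ∀ v → Dec (v ∈ S × Far z v)
    T? v = (v ∈? S) ×-dec far? z v
    T : Subset n
    T = select T?
    T⊆S : T ⊆ S
    T⊆S = proj₁ ∘ ∈-select⁻ T?
    T-far : ∀ {v} → v ∈ T → Far z v
    T-far = proj₂ ∘ ∈-select⁻ T?
    open Component (component {T} {a} (∈-select⁺ T? (a∈S , a-far)))
    N? : ∀ v → Dec (v ∈ S × v ∉ C × ∃[ c ] c ∈ C × Adj G c v)
    N? v = (v ∈? S) ×-dec ¬? (v ∈? C) ×-dec any? (λ c → (c ∈? C) ×-dec adj? G c v)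
    N : Subset n
    N = select N?
    -- A neighbour of `C` that is far from `z` would lie in `T`, and hence in the component itself.
    N⊆N[z] : ∀ {v} → v ∈ N → Adj G z v
    N⊆N[z] {v} v∈N with ∈-select⁻ N? v∈N
    ... | v∈S , v∉C , c , c∈C , cv = decidable-stable (adj? G z v) λ z≁v →
      v∉C (closed c∈C (∈-select⁺ T? (v∈S , (λ { refl → proj₂ (T-far (C⊆T c∈C)) (adj-sym G cv) }) , z≁v)) cv)
    N-clique : IsClique G N
    N-clique = S⊆V ∘ proj₁ ∘ ∈-select⁻ N? , clique
      where
      -- Two non-adjacent vertices of `N` would be linked through the connected set `C`, which is
      -- far from their common neighbour `z`.
      clique : ∀ {u w} → u ∈ N → w ∈ N → u ≢ w → Adj G u w
      clique {u} {w} u∈N w∈N u≢w with ∈-select⁻ N? u∈N | ∈-select⁻ N? w∈N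
      ... | _ , _ , b , b∈C , bu | _ , _ , c , c∈C , cw = decidable-stable (adj? G u w) λ u≁w →
        no-detour chordal u≢w u≁w (N⊆N[z] u∈N) (N⊆N[z] w∈N) T-far (C⊆T b∈C)
          (reverse (adj-sym (G [ T ])) (connected b∈C) ◅◅ connected c∈C) (C⊆T c∈C) (adj-sym G bu) cw
    C∪N⊆S : C ∪ N ⊆ S
    C∪N⊆S = [ T⊆S ∘ C⊆T , proj₁ ∘ ∈-select⁻ N? ]′ ∘ x∈p∪q⁻ C N
    z∉C∪N : z ∉ C ∪ N
    z∉C∪N = [ (λ z∈C → proj₁ (T-far (C⊆T z∈C)) refl) , (λ z∈N → irrefl G refl (N⊆N[z] z∈N)) ]′
              ∘ x∈p∪q⁻ C N
    -- The set `C ∪ N` is smaller because it misses `z`. A simplicial vertex outside `N` lies in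
    -- `C`, so it is far from `z`, and `C ∪ N` contains all its neighbours in `S`.
    found = ih (S⊆V ∘ C∪N⊆S) (p⊂q⇒∣p∣<∣q∣ (C∪N⊆S , z , z∈S , z∉C∪N)) N-clique
      (a , x∈p∪q⁺ (inj₁ a∈C) , λ a∈N → proj₁ (proj₂ (∈-select⁻ N? a∈N)) a∈C)
    v = proj₁ found
    v∈C : v ∈ C
    v∈C = [ id , (λ v∈N → contradiction v∈N (proj₁ (proj₂ (proj₂ found)))) ]′
            (x∈p∪q⁻ C N (proj₁ (proj₂ found)))
    simplicial = proj₂ (proj₂ (proj₂ found))
    closed-nbhd : ∀ {c u} → c ∈ C → u ∈ S → Adj G c u → u ∈ C ∪ N
    closed-nbhd {c} {u} c∈C u∈S cu with u ∈? C
    ... | yes u∈C = x∈p∪q⁺ (inj₁ u∈C)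
    ... | no u∉C  = x∈p∪q⁺ (inj₂ (∈-select⁺ N? (u∈S , u∉C , c , c∈C , cu)))

  -- If some `z ∈ K` has a far vertex in `S`, a simplicial vertex far from `z` lies outside the
  -- clique `K`. Otherwise every vertex of `S` in `K` is adjacent to all the rest of `S`, so a
  -- simplicial vertex far from any `z` is outside `K`. If no far pair exists, `S` is a clique and
  -- `s` serves.
  chordal⇒dirac : Chordal G → Dirac G
  chordal⇒dirac chordal {S} S⊆V = at S⊆V (<-wellFounded ∣ S ∣)
    where
    FarPair : Subset n → (Fin n → Set) → Set
    FarPair S P = ∃[ z ] ∃[ a ] z ∈ S × P z × a ∈ S × Far z a

    at : ∀ {S} → S ⊆ V → Acc _<_ ∣ S ∣ → DiracAt S
    at {S} S⊆V (acc rs) {K} (_ , K-adj) (s , s∈S , s∉K) = by-cases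
      (any? λ z → any? λ a → (z ∈? S) ×-dec (z ∈? K) ×-dec (a ∈? S) ×-dec far? z a)
      (any? λ z → any? λ a → (z ∈? S) ×-dec ¬? (z ∈? K) ×-dec (a ∈? S) ×-dec far? z a)
      where
      by-cases : Dec (FarPair S (_∈ K)) → Dec (FarPair S (_∉ K)) →
                 ∃[ v ] v ∈ S × v ∉ K × Simplicial G S v
      by-cases (yes (z , a , z∈S , z∈K , a∈S , a-far)) _ =
        let v , v∈S , (v≢z , z≁v) , simplicial =
              far-simplicial chordal S⊆V (λ S′⊆V lt → at S′⊆V (rs lt)) z∈S a∈S a-far
        in v , v∈S , (λ v∈K → z≁v (K-adj z∈K v∈K (v≢z ∘ sym))) , simplicial
      by-cases (no K-universal) (yes (z , a , z∈S , _ , a∈S , a-far)) =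
        let v , v∈S , (v≢z , z≁v) , simplicial =
              far-simplicial chordal S⊆V (λ S′⊆V lt → at S′⊆V (rs lt)) z∈S a∈S a-far
        in v , v∈S
         , (λ v∈K → K-universal (v , z , v∈S , v∈K , z∈S , v≢z ∘ sym , z≁v ∘ adj-sym G))
         , simplicial
      by-cases (no K-universal) (no rest-universal) =
        s , s∈S , s∉K , λ {u} {w} u∈S w∈S _ _ u≢w →
          decidable-stable (adj? G u w) λ u≁w → near (u ∈? K) u∈S w∈S (u≢w ∘ sym , u≁w)
        where
        near : ∀ {u w} → Dec (u ∈ K) → u ∈ S → w ∈ S → ¬ Far u w
        near {u} {w} (yes u∈K) u∈S w∈S far = K-universal (u , w , u∈S , u∈K , w∈S , far)
        near {u} {w} (no u∉K)  u∈S w∈S far = rest-universal (u , w , u∈S , u∉K , w∈S , far)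

-- Balanced separators

∣p∪q∣+∣p∩q∣≡∣p∣+∣q∣ : ∀ {n} (p q : Subset n) → ∣ p ∪ q ∣ + ∣ p ∩ q ∣ ≡ ∣ p ∣ + ∣ q ∣
∣p∪q∣+∣p∩q∣≡∣p∣+∣q∣ [] [] = refl
∣p∪q∣+∣p∩q∣≡∣p∣+∣q∣ (inside ∷ p) (inside ∷ q) = cong suc (trans (ℕ.+-suc _ _)
  (trans (cong suc (∣p∪q∣+∣p∩q∣≡∣p∣+∣q∣ p q)) (sym (ℕ.+-suc _ _))))
∣p∪q∣+∣p∩q∣≡∣p∣+∣q∣ (inside ∷ p) (outside ∷ q) = cong suc (∣p∪q∣+∣p∩q∣≡∣p∣+∣q∣ p q)
∣p∪q∣+∣p∩q∣≡∣p∣+∣q∣ (outside ∷ p) (inside ∷ q) =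
  trans (cong suc (∣p∪q∣+∣p∩q∣≡∣p∣+∣q∣ p q)) (sym (ℕ.+-suc _ _))
∣p∪q∣+∣p∩q∣≡∣p∣+∣q∣ (outside ∷ p) (outside ∷ q) = ∣p∪q∣+∣p∩q∣≡∣p∣+∣q∣ p q

module _ {n : ℕ} where

  ∣p∪q∣≤∣p∣+∣q∣ : (p q : Subset n) → ∣ p ∪ q ∣ ≤ ∣ p ∣ + ∣ q ∣
  ∣p∪q∣≤∣p∣+∣q∣ p q = subst (∣ p ∪ q ∣ ≤_) (∣p∪q∣+∣p∩q∣≡∣p∣+∣q∣ p q) (ℕ.m≤m+n _ _)

  disjoint⇒∣p∣+∣q∣≤∣r∣ : {p q r : Subset n} → DisjointSets p q → p ⊆ r → q ⊆ r → ∣ p ∣ + ∣ q ∣ ≤ ∣ r ∣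
  disjoint⇒∣p∣+∣q∣≤∣r∣ {p} {q} {r} p∩q=∅ p⊆r q⊆r = begin
    ∣ p ∣ + ∣ q ∣          ≡⟨ ∣p∪q∣+∣p∩q∣≡∣p∣+∣q∣ p q ⟨
    ∣ p ∪ q ∣ + ∣ p ∩ q ∣  ≡⟨ cong (∣ p ∪ q ∣ +_) ∣p∩q∣≡0 ⟩
    ∣ p ∪ q ∣ + 0          ≡⟨ ℕ.+-identityʳ _ ⟩
    ∣ p ∪ q ∣              ≤⟨ p⊆q⇒∣p∣≤∣q∣ ([ p⊆r , q⊆r ]′ ∘ x∈p∪q⁻ p q) ⟩
    ∣ r ∣                  ∎
    where
    open ℕ.≤-Reasoning
    ∣p∩q∣≡0 : ∣ p ∩ q ∣ ≡ 0
    ∣p∩q∣≡0 = trans (cong ∣_∣ (Empty-unique λ (v , v∈) →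
      let (v∈p , v∈q) = x∈p∩q⁻ p q v∈ in p∩q=∅ v∈p v∈q)) (∣⊥∣≡0 n)

  module _ (S : Subset n) (v : Fin n) where

    without? : ∀ u → Dec (u ∈ S × u ≢ v)
    without? u = (u ∈? S) ×-dec ¬? (u Fin.≟ v)

    without : Subset n
    without = select without?

    ∈-without⁺ : ∀ {u} → u ∈ S → u ≢ v → u ∈ without
    ∈-without⁺ u∈S u≢v = ∈-select⁺ without? (u∈S , u≢v)

    without-⊆ : without ⊆ S
    without-⊆ = proj₁ ∘ ∈-select⁻ without?

    without-≢ : ∀ {u} → u ∈ without → u ≢ v
    without-≢ = proj₂ ∘ ∈-select⁻ without?

    without-cover : ∀ {u} → u ∈ S → u ∈ without ⊎ u ≡ v
    without-cover {u} u∈S with u Fin.≟ v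
    ... | yes u≡v = inj₂ u≡v
    ... | no u≢v  = inj₁ (∈-without⁺ u∈S u≢v)

    ∣without∣<∣S∣ : v ∈ S → ∣ without ∣ < ∣ S ∣
    ∣without∣<∣S∣ v∈S = p⊂q⇒∣p∣<∣q∣ (without-⊆ , v , v∈S , λ v∈ → without-≢ v∈ refl)

  ∈-∪⁅⁆⁻ : ∀ (S : Subset n) v {u} → u ∈ S ∪ ⁅ v ⁆ → u ∈ S ⊎ u ≡ v
  ∈-∪⁅⁆⁻ S v = Sum.map₂ (x∈⁅y⁆⇒x≡y v) ∘ x∈p∪q⁻ S ⁅ v ⁆

  v∈S∪⁅v⁆ : ∀ {S : Subset n} v → v ∈ S ∪ ⁅ v ⁆
  v∈S∪⁅v⁆ v = x∈p∪q⁺ (inj₂ (x∈⁅x⁆ v))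

-- Reducing a set of vertices next to a clique

module _ {n : ℕ} {V : Subset n} (H : Graph V) where

  data Reduction (X U : Subset n) : Set where
    missed : ∀ x → x ∈ X → (∀ {u} → u ∈ U → ¬ Adj H x u) → Reduction X U
    splits : ∀ U₁ U₂ → Nonempty U₁ → Nonempty U₂ → U₁ ⊆ U → U₂ ⊆ U →
             (∀ {u} → u ∈ U → u ∈ U₁ ⊎ u ∈ U₂) → DisjointSets U₁ U₂ →
             NoEdgesBetween H U₁ U₂ → Reduction X U
    apex   : ∀ v → v ∈ U → (∀ {x} → x ∈ X → Adj H v x) → Reduction X U

  -- The Dirac property for `X ∪ U` and the clique `X` gives a simplicial `v ∈ U`. If `v` is
  -- adjacent to all of `X`, it is an apex. Otherwise a reduction for `U` without `v` carries over,
  -- because the neighbours of `v` in `X ∪ U` form a clique.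
  reduce : Dirac H → ∀ {X U} → IsClique H X → U ⊆ V → DisjointSets X U → Nonempty U →
           Acc _<_ ∣ U ∣ → Reduction X U
  reduce dirac {X} {U} X-clique U⊆V X∩U=∅ (u₀ , u₀∈U) (acc rs) =
    at-v (any? λ x → (x ∈? X) ×-dec ¬? (adj? H v x))
    where
    found : ∃[ v ] v ∈ X ∪ U × v ∉ X × Simplicial H (X ∪ U) v
    found = dirac ([ proj₁ X-clique , U⊆V ]′ ∘ x∈p∪q⁻ X U) X-clique
      (u₀ , x∈p∪q⁺ (inj₂ u₀∈U) , λ u₀∈X → X∩U=∅ u₀∈X u₀∈U)
    v : Fin n
    v = proj₁ found
    v∈U : v ∈ U
    v∈U = [ (λ v∈X → contradiction v∈X (proj₁ (proj₂ (proj₂ found)))) , id ]′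
            (x∈p∪q⁻ X U (proj₁ (proj₂ found)))
    simplicial : Simplicial H (X ∪ U) v
    simplicial = proj₂ (proj₂ (proj₂ found))
    U′ : Subset n
    U′ = without U v
    U′⊆U : U′ ⊆ U
    U′⊆U = without-⊆ U v

    U⁻ : ∀ {u} → u ∈ U → u ∈ U′ ⊎ u ≡ v
    U⁻ = without-cover U v

    -- The vertex `v` joins the part `U₁`, which may be empty; then `v` is a part by itself.
    attach : ∀ U₁ U₂ → Nonempty U₂ → U₁ ⊆ U′ → U₂ ⊆ U′ →
             (∀ {u} → u ∈ U′ → u ∈ U₁ ⊎ u ∈ U₂) → DisjointSets U₁ U₂ →
             NoEdgesBetween H U₁ U₂ → (∀ {w} → w ∈ U₂ → ¬ Adj H v w) → Reduction X U
    attach U₁ U₂ ne₂ U₁⊆U′ U₂⊆U′ cover U₁∩U₂=∅ U₁≁U₂ v≁U₂ =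
      splits (U₁ ∪ ⁅ v ⁆) U₂ (v , v∈S∪⁅v⁆ v) ne₂
        ([ U′⊆U ∘ U₁⊆U′ , (λ { refl → v∈U }) ]′ ∘ ∈-∪⁅⁆⁻ U₁ v) (U′⊆U ∘ U₂⊆U′)
        ([ Sum.map₁ (x∈p∪q⁺ ∘ inj₁) ∘ cover , (λ { refl → inj₁ (v∈S∪⁅v⁆ v) }) ]′ ∘ U⁻)
        (λ u∈ u∈U₂ → [ (λ u∈U₁ → U₁∩U₂=∅ u∈U₁ u∈U₂)
                     , without-≢ U v (U₂⊆U′ u∈U₂) ]′ (∈-∪⁅⁆⁻ U₁ v u∈))
        (λ u∈ w∈U₂ → [ (λ u∈U₁ → U₁≁U₂ u∈U₁ w∈U₂) , (λ { refl → v≁U₂ w∈U₂ }) ]′ (∈-∪⁅⁆⁻ U₁ v u∈))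

    nbrs-adjacent : ∀ {u w} → u ∈ X ∪ U → w ∈ U → u ≢ w → Adj H v u → Adj H v w → Adj H u w
    nbrs-adjacent u∈ w∈U u≢w vu vw = simplicial u∈ (x∈p∪q⁺ (inj₂ w∈U)) vu vw u≢w

    extend : Nonempty U′ → Reduction X U′ → Reduction X U
    extend _ (apex w w∈U′ wX) = apex w (U′⊆U w∈U′) wX
    extend ne (missed x x∈X x≁U′) = at-x (adj? H v x)
      where
      at-x : Dec (Adj H v x) → Reduction X U
      at-x (no v≁x) = missed x x∈X ([ x≁U′ , (λ { refl → v≁x ∘ adj-sym H }) ]′ ∘ U⁻)
      -- A neighbour of `v` in `U′` would be adjacent to `x`, which misses `U′`; hence `v` is
      -- isolated from `U′`.
      at-x (yes vx) = attach ⊥ U′ ne (λ u∈ → contradiction u∈ ∉⊥) id inj₂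
        (λ u∈ → contradiction u∈ ∉⊥) (λ u∈ → contradiction u∈ ∉⊥)
        (λ w∈U′ vw → x≁U′ w∈U′ (nbrs-adjacent (x∈p∪q⁺ (inj₁ x∈X)) (U′⊆U w∈U′)
          (λ { refl → X∩U=∅ x∈X (U′⊆U w∈U′) }) vx vw))
    extend _ (splits U₁ U₂ ne₁ ne₂ U₁⊆U′ U₂⊆U′ cover U₁∩U₂=∅ U₁≁U₂) =
      -- Neighbours of `v` in both parts would be adjacent to each other, so `v` can join a part
      -- containing its neighbours.
      by-nbr (any? λ u → (u ∈? U₁) ×-dec adj? H v u)
      where
      by-nbr : Dec (∃[ u ] u ∈ U₁ × Adj H v u) → Reduction X U
      by-nbr (yes (u , u∈U₁ , vu)) = attach U₁ U₂ ne₂ U₁⊆U′ U₂⊆U′ cover U₁∩U₂=∅ U₁≁U₂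
        (λ w∈U₂ vw → U₁≁U₂ u∈U₁ w∈U₂
          (nbrs-adjacent (x∈p∪q⁺ (inj₂ (U′⊆U (U₁⊆U′ u∈U₁)))) (U′⊆U (U₂⊆U′ w∈U₂))
            (λ { refl → U₁∩U₂=∅ u∈U₁ w∈U₂ }) vu vw))
      by-nbr (no v≁U₁) = attach U₂ U₁ ne₁ U₂⊆U′ U₁⊆U′ (Sum.swap ∘ cover)
        (λ u∈U₂ u∈U₁ → U₁∩U₂=∅ u∈U₁ u∈U₂) (λ u∈U₂ w∈U₁ → U₁≁U₂ w∈U₁ u∈U₂ ∘ adj-sym H)
        (λ w∈U₁ vw → v≁U₁ (_ , w∈U₁ , vw))

    at-v : Dec (∃[ x ] x ∈ X × ¬ Adj H v x) → Reduction X U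
    at-v (no all) = apex v v∈U λ {x} x∈X →
      decidable-stable (adj? H v x) λ v≁x → all (x , x∈X , v≁x)
    at-v (yes (x , x∈X , v≁x)) = rest (nonempty? U′)
      where
      rest : Dec (Nonempty U′) → Reduction X U
      rest (yes ne) = extend ne (reduce dirac X-clique (U⊆V ∘ U′⊆U)
        (λ u∈X → X∩U=∅ u∈X ∘ U′⊆U) ne (rs (∣without∣<∣S∣ U v v∈U)))
      rest (no empty) = missed x x∈X
        ([ (λ u∈U′ → contradiction (_ , u∈U′) empty) , (λ { refl → v≁x ∘ adj-sym H }) ]′ ∘ U⁻)

module _ {n : ℕ} (W : Subset n) where

  Light : Subset n → Set
  Light S = ∣ W ∩ S ∣ + ∣ W ∩ S ∣ ≤ ∣ W ∣

  light? : ∀ S → Dec (Light S)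
  light? S = ∣ W ∩ S ∣ + ∣ W ∩ S ∣ ℕ.≤? ∣ W ∣

  light-⊆ : ∀ {S T} → S ⊆ T → Light T → Light S
  light-⊆ {S} {T} S⊆T = ℕ.≤-trans (ℕ.+-mono-≤ W∩S≤W∩T W∩S≤W∩T)
    where
    W∩S≤W∩T : ∣ W ∩ S ∣ ≤ ∣ W ∩ T ∣
    W∩S≤W∩T = p⊆q⇒∣p∣≤∣q∣ λ v∈ →
      let (v∈W , v∈S) = x∈p∩q⁻ W S v∈ in x∈p∩q⁺ (v∈W , S⊆T v∈S)

  light-⊥ : Light ⊥
  light-⊥ = subst (λ s → s + s ≤ ∣ W ∣) (sym W∩⊥≡0) z≤n
    where
    W∩⊥≡0 : ∣ W ∩ ⊥ ∣ ≡ 0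
    W∩⊥≡0 = ℕ.n≤0⇒n≡0 (subst (∣ W ∩ ⊥ ∣ ≤_) (∣⊥∣≡0 n) (∣p∩q∣≤∣q∣ W ⊥))

  heavy⇒light : ∀ {S T} → ¬ Light S → DisjointSets S T → Light T
  heavy⇒light {S} {T} heavy S∩T=∅ = by-weight (ℕ.≤-total ∣ W ∩ S ∣ ∣ W ∩ T ∣)
    where
    total : ∣ W ∩ S ∣ + ∣ W ∩ T ∣ ≤ ∣ W ∣
    total = disjoint⇒∣p∣+∣q∣≤∣r∣
      (λ v∈ v∈′ → S∩T=∅ (proj₂ (x∈p∩q⁻ W S v∈)) (proj₂ (x∈p∩q⁻ W T v∈′)))
      (proj₁ ∘ x∈p∩q⁻ W S) (proj₁ ∘ x∈p∩q⁻ W T)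
    by-weight : ∣ W ∩ S ∣ ≤ ∣ W ∩ T ∣ ⊎ ∣ W ∩ T ∣ ≤ ∣ W ∩ S ∣ → Light T
    by-weight (inj₁ S≤T) =
      contradiction (ℕ.≤-trans (ℕ.+-monoʳ-≤ ∣ W ∩ S ∣ S≤T) total) heavy
    by-weight (inj₂ T≤S) = ℕ.≤-trans (ℕ.+-monoˡ-≤ ∣ W ∩ T ∣ T≤S) total

module _ {n : ℕ} {V : Subset n} (G : Graph V) (k : ℕ) (W : Subset n) where

  -- When `∣ X ∣ ≤ k`, either alternative bounds `∣ (W ∩ S) ∪ X ∣` by less than `(α + 1)k`.
  Fits : Subset n → Subset n → Set
  Fits X S = Light W S ⊎ ∣ S ∪ X ∣ ≤ k

  record BalancedDecomposition : Set where
    field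
      decomposition : Decomposition G
    open Decomposition decomposition public
    field
      ∣X∣≤k  : ∣ X ∣ ≤ k
      A-fits : Fits X A
      B-fits : Fits X B
      C-fits : Fits X C

module _ {n : ℕ} (V X U : Subset n) where

  private
    outer? : ∀ v → Dec (v ∈ V × v ∉ X × v ∉ U)
    outer? v = (v ∈? V) ×-dec ¬? (v ∈? X) ×-dec ¬? (v ∈? U)

  outer : Subset n
  outer = select outer?

  outer⁺ : ∀ {v} → v ∈ V → v ∉ X → v ∉ U → v ∈ outer
  outer⁺ v∈V v∉X v∉U = ∈-select⁺ outer? (v∈V , v∉X , v∉U)

  outer⁻ : ∀ {v} → v ∈ outer → v ∈ V × v ∉ X × v ∉ U
  outer⁻ = ∈-select⁻ outer?

  outer-cover : ∀ {v} → v ∈ V → v ∈ X ⊎ v ∈ U ⊎ v ∈ outer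
  outer-cover {v} v∈V with v ∈? X | v ∈? U
  ... | yes v∈X | _       = inj₁ v∈X
  ... | no _    | yes v∈U = inj₂ (inj₁ v∈U)
  ... | no v∉X  | no v∉U  = inj₂ (inj₂ (outer⁺ v∈V v∉X v∉U))

-- Balanced decompositions from a supergraph with small cliques

module _ {n : ℕ} {V : Subset n} {G H : Graph V} (G⊆H : ∀ {u v} → Adj G u v → Adj H u v)
         (dirac : Dirac H) {k : ℕ} (∣clique∣≤k : ∀ {K} → IsClique H K → ∣ K ∣ ≤ k)
         (k<∣V∣ : k < ∣ V ∣) (W : Subset n) where

  -- X is a clique separating U from the rest of the graph, which is light.
  record Separation (X U : Subset n) : Set where
    field
      X-clique    : IsClique H X
      U⊆V         : U ⊆ V
      X∩U=∅       : DisjointSets X U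
      U-nonempty  : Nonempty U
      neighbours  : ∀ {u w} → u ∈ U → Adj H u w → w ∈ X ⊎ w ∈ U
      outer-light : Light W (outer V X U)

  balanced : ∀ {X A B C} → X ⊆ V → A ⊆ V → B ⊆ V → C ⊆ V →
    (∀ {v} → v ∈ V → v ∈ X ⊎ v ∈ A ⊎ v ∈ B ⊎ v ∈ C) →
    DisjointSets X A → DisjointSets X B → DisjointSets X C →
    DisjointSets A B → DisjointSets A C → DisjointSets B C →
    Nonempty A → Nonempty B →
    NoEdgesBetween H A B → NoEdgesBetween H A C → NoEdgesBetween H B C →
    ∣ X ∣ ≤ k → Fits G k W X A → Fits G k W X B → Fits G k W X C →
    BalancedDecomposition G k W
  balanced {X} {A} {B} {C} X⊆V A⊆V B⊆V C⊆V cover XA XB XC AB AC BC neA neB A≁B A≁C B≁C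
           ∣X∣≤k fitsA fitsB fitsC = record
    { decomposition = record
      { X = X ; A = A ; B = B ; C = C
      ; partition = ⊆-antisym
          ([ X⊆V , [ A⊆V , [ B⊆V , C⊆V ]′ ∘ x∈p∪q⁻ B C ]′ ∘ x∈p∪q⁻ A (B ∪ C) ]′
            ∘ x∈p∪q⁻ X (A ∪ B ∪ C))
          (x∈p∪q⁺ ∘ Sum.map₂ (x∈p∪q⁺ ∘ Sum.map₂ x∈p∪q⁺) ∘ cover)
      ; X∩A=∅ = XA ; X∩B=∅ = XB ; X∩C=∅ = XC ; A∩B=∅ = AB ; A∩C=∅ = AC ; B∩C=∅ = BC
      ; A-nonempty = neA ; B-nonempty = neB
      ; A-B = λ a∈ b∈ → A≁B a∈ b∈ ∘ G⊆H
      ; A-C = λ a∈ c∈ → A≁C a∈ c∈ ∘ G⊆H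
      ; B-C = λ b∈ c∈ → B≁C b∈ c∈ ∘ G⊆H
      }
    ; ∣X∣≤k = ∣X∣≤k ; A-fits = fitsA ; B-fits = fitsB ; C-fits = fitsC
    }

  private
    ∉⊥′ : ∀ {P : Set} {v : Fin n} → v ∈ ⊥ → P
    ∉⊥′ v∈⊥ = contradiction v∈⊥ ∉⊥

  module _ {X U : Subset n} (sep : Separation X U) where
    open Separation sep

    private
      O : Subset n
      O = outer V X U

    X⊆V′ : X ⊆ V
    X⊆V′ = proj₁ X-clique

    U≁outer : NoEdgesBetween H U O
    U≁outer u∈U w∈O uw = [ proj₁ (proj₂ (outer⁻ V X U w∈O)) , proj₂ (proj₂ (outer⁻ V X U w∈O)) ]′
      (neighbours u∈U uw)

    balanced-outer : Nonempty O → Fits G k W X U → BalancedDecomposition G k W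
    balanced-outer ne fits = balanced {C = ⊥} X⊆V′ U⊆V (proj₁ ∘ outer⁻ V X U) ∉⊥′
      (Sum.map₂ (Sum.map₂ inj₁) ∘ outer-cover V X U)
      X∩U=∅ (λ v∈X v∈O → proj₁ (proj₂ (outer⁻ V X U v∈O)) v∈X) (λ _ → ∉⊥)
      (λ v∈U v∈O → proj₂ (proj₂ (outer⁻ V X U v∈O)) v∈U) (λ _ → ∉⊥) (λ _ → ∉⊥)
      U-nonempty ne U≁outer (λ _ → ∉⊥′) (λ _ → ∉⊥′)
      (∣clique∣≤k X-clique) fits (inj₁ outer-light) (inj₁ (light-⊥ W))

    -- With nothing outside `X ∪ U`, the vertex `x` itself serves as the first part. It fits because
    -- its union with the rest of `X` is still a clique.
    balanced-missed : ∀ {x} → x ∈ X → (∀ {u} → u ∈ U → ¬ Adj H x u) →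
                      ¬ Nonempty O → Light W U → BalancedDecomposition G k W
    balanced-missed {x} x∈X x≁U empty light = balanced {without X x} {⁅ x ⁆} {U} {⊥}
      (X⊆V′ ∘ without-⊆ X x) (X⊆V′ ∘ ⁅x⁆⊆X) U⊆V ∉⊥′
      ([ Sum.map₂ inj₁ ∘ split
       , [ inj₂ ∘ inj₂ ∘ inj₁ , (λ v∈O → contradiction (_ , v∈O) empty) ]′ ]′ ∘ outer-cover V X U)
      (λ v∈ v∈⁅x⁆ → without-≢ X x v∈ (x∈⁅y⁆⇒x≡y x v∈⁅x⁆))
      (X∩U=∅ ∘ without-⊆ X x) (λ _ → ∉⊥)
      (X∩U=∅ ∘ ⁅x⁆⊆X) (λ _ → ∉⊥) (λ _ → ∉⊥)
      (x , x∈⁅x⁆ x) U-nonempty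
      (λ {v} {u} v∈ u∈U vu → x≁U u∈U (subst (λ v → Adj H v u) (x∈⁅y⁆⇒x≡y x v∈) vu))
      (λ _ → ∉⊥′) (λ _ → ∉⊥′)
      (∣clique∣≤k (clique-⊆ H (without-⊆ X x) X-clique))
      (inj₂ (∣clique∣≤k (clique-⊆ H
        ([ ⁅x⁆⊆X , without-⊆ X x ]′ ∘ x∈p∪q⁻ ⁅ x ⁆ (without X x)) X-clique)))
      (inj₁ light) (inj₁ (light-⊥ W))
      where
      ⁅x⁆⊆X : ⁅ x ⁆ ⊆ X
      ⁅x⁆⊆X v∈ = subst (_∈ X) (sym (x∈⁅y⁆⇒x≡y x v∈)) x∈X
      split : ∀ {v} → v ∈ X → v ∈ without X x ⊎ v ∈ ⁅ x ⁆
      split = Sum.map₂ (λ { refl → x∈⁅x⁆ x }) ∘ without-cover X x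

    -- Moving `x` to the outer set keeps that set light, since it is disjoint from the heavy `U`.
    drop-missed : ∀ {x} → (∀ {u} → u ∈ U → ¬ Adj H x u) → ¬ Light W U → Separation (without X x) U
    drop-missed {x} x≁U heavy = record
      { X-clique    = clique-⊆ H (without-⊆ X x) X-clique
      ; U⊆V         = U⊆V
      ; X∩U=∅       = X∩U=∅ ∘ without-⊆ X x
      ; U-nonempty  = U-nonempty
      ; neighbours  = λ u∈U uw → Sum.map₁
          (λ w∈X → ∈-without⁺ X x w∈X λ { refl → x≁U u∈U (adj-sym H uw) }) (neighbours u∈U uw)
      ; outer-light = heavy⇒light W heavy
          (λ v∈U v∈O → proj₂ (proj₂ (outer⁻ V (without X x) U v∈O)) v∈U)
      }

    balanced-splits : ∀ {U₁ U₂} → Nonempty U₁ → Nonempty U₂ → U₁ ⊆ U → U₂ ⊆ U →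
      (∀ {u} → u ∈ U → u ∈ U₁ ⊎ u ∈ U₂) → DisjointSets U₁ U₂ → NoEdgesBetween H U₁ U₂ →
      Light W U₁ → Light W U₂ → BalancedDecomposition G k W
    balanced-splits ne₁ ne₂ U₁⊆U U₂⊆U cover U₁∩U₂=∅ U₁≁U₂ light₁ light₂ = balanced
      X⊆V′ (U⊆V ∘ U₁⊆U) (U⊆V ∘ U₂⊆U) (proj₁ ∘ outer⁻ V X U)
      (Sum.map₂ ([ Sum.map₂ inj₁ ∘ cover , inj₂ ∘ inj₂ ]′) ∘ outer-cover V X U)
      (λ v∈X → X∩U=∅ v∈X ∘ U₁⊆U) (λ v∈X → X∩U=∅ v∈X ∘ U₂⊆U)
      (λ v∈X v∈O → proj₁ (proj₂ (outer⁻ V X U v∈O)) v∈X)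
      U₁∩U₂=∅ (λ v∈ v∈O → proj₂ (proj₂ (outer⁻ V X U v∈O)) (U₁⊆U v∈))
      (λ v∈ v∈O → proj₂ (proj₂ (outer⁻ V X U v∈O)) (U₂⊆U v∈))
      ne₁ ne₂ U₁≁U₂ (U≁outer ∘ U₁⊆U) (U≁outer ∘ U₂⊆U)
      (∣clique∣≤k X-clique) (inj₁ light₁) (inj₁ light₂) (inj₁ outer-light)

    -- The other part joins the outer set, which remains light because it is disjoint from the heavy
    -- `U₁`.
    keep-heavy : ∀ {U₁ U₂} → Nonempty U₁ → U₁ ⊆ U → (∀ {u} → u ∈ U → u ∈ U₁ ⊎ u ∈ U₂) →
      NoEdgesBetween H U₁ U₂ → ¬ Light W U₁ → Separation X U₁
    keep-heavy {U₁} ne₁ U₁⊆U cover U₁≁U₂ heavy = record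
      { X-clique    = X-clique
      ; U⊆V         = U⊆V ∘ U₁⊆U
      ; X∩U=∅       = λ v∈X → X∩U=∅ v∈X ∘ U₁⊆U
      ; U-nonempty  = ne₁
      ; neighbours  = λ u∈ uw → Sum.map₂
          ([ id , (λ w∈U₂ → contradiction uw (U₁≁U₂ u∈ w∈U₂)) ]′ ∘ cover)
          (neighbours (U₁⊆U u∈) uw)
      ; outer-light = heavy⇒light W heavy (λ v∈ v∈O → proj₂ (proj₂ (outer⁻ V X U₁ v∈O)) v∈)
      }

    module _ {v : Fin n} (v∈U : v ∈ U) (vX : ∀ {x} → x ∈ X → Adj H v x) where

      U⁻ : ∀ {u} → u ∈ U → u ∈ without U v ⊎ u ≡ v
      U⁻ = without-cover U v

      apex-clique : IsClique H (X ∪ ⁅ v ⁆)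
      apex-clique = [ X⊆V′ , (λ { refl → U⊆V v∈U }) ]′ ∘ ∈-∪⁅⁆⁻ X v
                  , λ u∈ w∈ → adj (∈-∪⁅⁆⁻ X v u∈) (∈-∪⁅⁆⁻ X v w∈)
        where
        adj : ∀ {u w} → u ∈ X ⊎ u ≡ v → w ∈ X ⊎ w ≡ v → u ≢ w → Adj H u w
        adj (inj₁ u∈X)  (inj₁ w∈X)  u≢w = proj₂ X-clique u∈X w∈X u≢w
        adj (inj₁ u∈X)  (inj₂ refl) _   = adj-sym H (vX u∈X)
        adj (inj₂ refl) (inj₁ w∈X)  _   = vX w∈X
        adj (inj₂ refl) (inj₂ refl) u≢u = contradiction refl u≢u

      absorb-apex : Nonempty (without U v) → Separation (X ∪ ⁅ v ⁆) (without U v)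
      absorb-apex ne = record
        { X-clique    = apex-clique
        ; U⊆V         = U⊆V ∘ without-⊆ U v
        ; X∩U=∅       = λ w∈ w∈U′ → [ (λ w∈X → X∩U=∅ w∈X (without-⊆ U v w∈U′))
                                    , without-≢ U v w∈U′ ]′ (∈-∪⁅⁆⁻ X v w∈)
        ; U-nonempty  = ne
        ; neighbours  = λ u∈ uw → [ inj₁ ∘ x∈p∪q⁺ ∘ inj₁
                                  , Sum.swap ∘ Sum.map₂ (λ { refl → v∈S∪⁅v⁆ v }) ∘ U⁻ ]′
                                  (neighbours (without-⊆ U v u∈) uw)
        ; outer-light = light-⊆ W (λ w∈ →
            let (w∈V , w∉X∪v , w∉U′) = outer⁻ V (X ∪ ⁅ v ⁆) (without U v) w∈
            in outer⁺ V X U w∈V (w∉X∪v ∘ x∈p∪q⁺ ∘ inj₁)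
                 ([ w∉U′ , (λ { refl → w∉X∪v (v∈S∪⁅v⁆ v) }) ]′ ∘ U⁻)) outer-light
        }

      balanced-apex : ¬ Nonempty (without U v) → Nonempty O → BalancedDecomposition G k W
      balanced-apex empty ne = balanced-outer ne (inj₂ (∣clique∣≤k (clique-⊆ H
        ([ [ (λ u∈ → contradiction (_ , u∈) empty) , (λ { refl → v∈S∪⁅v⁆ v }) ]′ ∘ U⁻
         , x∈p∪q⁺ ∘ inj₁ ]′ ∘ x∈p∪q⁻ U X) apex-clique)))

      -- Otherwise `V` would be contained in the clique `X ∪ ⁅ v ⁆`, contradicting `k < ∣ V ∣`.
      apex-outer-nonempty : ¬ Nonempty (without U v) → ¬ ¬ Nonempty O
      apex-outer-nonempty empty emptyO = ℕ.<⇒≱ k<∣V∣ (ℕ.≤-trans (p⊆q⇒∣p∣≤∣q∣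
        ([ x∈p∪q⁺ ∘ inj₁
         , [ [ (λ u∈ → contradiction (_ , u∈) empty) , (λ { refl → v∈S∪⁅v⁆ v }) ]′ ∘ U⁻
           , (λ w∈ → contradiction (_ , w∈) emptyO) ]′ ]′ ∘ outer-cover V X U))
        (∣clique∣≤k apex-clique))

  separation-step : ∀ {X U} → Separation X U →
    (∀ {X′ U′} → ∣ U′ ∣ < ∣ U ∣ → Separation X′ U′ → BalancedDecomposition G k W) →
    (∀ {X′} → ∣ X′ ∣ < ∣ X ∣ → Separation X′ U → BalancedDecomposition G k W) →
    BalancedDecomposition G k W
  separation-step {X} {U} sep shrink-U shrink-X = start (nonempty? (outer V X U)) (light? W U)
    where
    open Separation sep

    -- A light `U` beside a nonempty outer set is balanced already. The second argument records that
    -- only the remaining cases arrive here: a light `U` has an empty outer set.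
    by-reduction : Reduction H X U → (Light W U → ¬ Nonempty (outer V X U)) →
                   Dec (Nonempty (outer V X U)) → Dec (Light W U) → BalancedDecomposition G k W
    by-reduction (missed x x∈X x≁U) excl _ (yes light) =
      balanced-missed sep x∈X x≁U (excl light) light
    by-reduction (missed x x∈X x≁U) _ _ (no heavy) =
      shrink-X (∣without∣<∣S∣ X x x∈X) (drop-missed sep x≁U heavy)
    by-reduction (splits U₁ U₂ ne₁@(_ , u₁∈) ne₂@(_ , u₂∈) U₁⊆U U₂⊆U cover U₁∩U₂=∅ U₁≁U₂) _ _ _ =
      by-weight (light? W U₁) (light? W U₂)
      where
      by-weight : Dec (Light W U₁) → Dec (Light W U₂) → BalancedDecomposition G k W
      by-weight (yes light₁) (yes light₂) =
        balanced-splits sep ne₁ ne₂ U₁⊆U U₂⊆U cover U₁∩U₂=∅ U₁≁U₂ light₁ light₂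
      by-weight (no heavy₁) _ = shrink-U
        (p⊂q⇒∣p∣<∣q∣ (U₁⊆U , _ , U₂⊆U u₂∈ , λ u₂∈U₁ → U₁∩U₂=∅ u₂∈U₁ u₂∈))
        (keep-heavy sep ne₁ U₁⊆U cover U₁≁U₂ heavy₁)
      by-weight (yes _) (no heavy₂) = shrink-U
        (p⊂q⇒∣p∣<∣q∣ (U₂⊆U , _ , U₁⊆U u₁∈ , U₁∩U₂=∅ u₁∈))
        (keep-heavy sep ne₂ U₂⊆U (Sum.swap ∘ cover)
          (λ u∈U₂ w∈U₁ → U₁≁U₂ w∈U₁ u∈U₂ ∘ adj-sym H) heavy₂)
    by-reduction (apex v v∈U vX) _ outer? _ = by-rest (nonempty? (without U v)) outer?
      where
      by-rest : Dec (Nonempty (without U v)) → Dec (Nonempty (outer V X U)) →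
                BalancedDecomposition G k W
      by-rest (yes ne)   _         = shrink-U (∣without∣<∣S∣ U v v∈U)
                                       (absorb-apex sep v∈U vX ne)
      by-rest (no empty) (yes neO) = balanced-apex sep v∈U vX empty neO
      by-rest (no empty) (no emptyO) =
        contradiction emptyO (apex-outer-nonempty sep v∈U vX empty)

    reduction : Reduction H X U
    reduction = reduce H dirac X-clique U⊆V X∩U=∅ U-nonempty (<-wellFounded _)

    start : Dec (Nonempty (outer V X U)) → Dec (Light W U) → BalancedDecomposition G k W
    start (yes neO) (yes light) = balanced-outer sep neO (inj₁ light)
    start (yes neO) (no heavy)  = by-reduction reduction (λ light → contradiction light heavy)
                                    (yes neO) (no heavy)
    start (no emptyO) light     = by-reduction reduction (λ _ → emptyO) (no emptyO) light

  -- The induction is lexicographic in `∣ U ∣` and then `∣ X ∣`, as absorbing an apex shrinks `U`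
  -- but enlarges `X`.
  separate : ∀ {X U} → Acc _<_ ∣ U ∣ → Acc _<_ ∣ X ∣ → Separation X U → BalancedDecomposition G k W
  separate (acc rsU) (acc rsX) sep = separation-step sep
    (λ lt → separate (rsU lt) (<-wellFounded _)) (λ lt → separate (acc rsU) (rsX lt))

  balancedDecomposition : BalancedDecomposition G k W
  balancedDecomposition = separate (<-wellFounded _) (<-wellFounded _) record
    { X-clique    = ∉⊥′ , λ v∈⊥ → ∉⊥′ v∈⊥
    ; U⊆V         = id
    ; X∩U=∅       = λ v∈⊥ → ∉⊥′ v∈⊥
    ; U-nonempty  = V-nonempty (nonempty? V)
    ; neighbours  = λ _ uw → inj₂ (proj₂ (within H uw))
    ; outer-light = light-⊆ W (λ w∈ → let (w∈V , _ , w∉V) = outer⁻ V ⊥ V w∈ in contradiction w∈V w∉V)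
                      (light-⊥ W)
    }
    where
    V-nonempty : Dec (Nonempty V) → Nonempty V
    V-nonempty (yes ne) = ne
    V-nonempty (no empty) = contradiction
      (subst (k <_) (trans (cong ∣_∣ (Empty-unique empty)) (∣⊥∣≡0 n)) k<∣V∣) ℕ.n≮0

-- Existence of the cliquewidth

least : ∀ {P : Pred ℕ 0ℓ} → Decidable P → ∀ {m} → P m → ∃[ w ] P w × (∀ {m} → P m → w ≤ m)
least {P} P? {m} = search (<-wellFounded m)
  where
  search : ∀ {m} → Acc _<_ m → P m → ∃[ w ] P w × (∀ {m} → P m → w ≤ m)
  search {m} (acc rs) Pm with ℕ.anyUpTo? P? m
  ... | yes (m′ , m′<m , Pm′) = search (rs m′<m) Pm′
  ... | no minimal = m , Pm , λ {m′} Pm′ → ℕ.≮⇒≥ λ m′<m → minimal (m′ , m′<m , Pm′)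

module _ {n : ℕ} where

  allSubsets? : ∀ {P : Pred (Subset n) 0ℓ} → Decidable P → Dec (∀ S → P S)
  allSubsets? P? = map′ (λ none S → decidable-stable (P? S) λ ¬PS → none (S , ¬PS))
                        (λ all (S , ¬PS) → ¬PS (all S))
                        (¬? (anySubset? (¬? ∘ P?)))

  largest : ∀ {P : Pred (Subset n) 0ℓ} → Decidable P → P ⊥ → ∀ b → (∀ S → P S → ∣ S ∣ ≤ b) →
            ∃[ m ] (∃[ S ] P S × ∣ S ∣ ≡ m) × (∀ S → P S → ∣ S ∣ ≤ m)
  largest P? P⊥ zero    bound = 0 , (⊥ , P⊥ , ∣⊥∣≡0 n) , bound
  largest P? P⊥ (suc b) bound with anySubset? (λ S → P? S ×-dec (∣ S ∣ ℕ.≟ suc b))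
  ... | yes attained = suc b , attained , bound
  ... | no ¬attained = largest P? P⊥ b λ S PS →
    ℕ.≤-pred (ℕ.≤∧≢⇒< (bound S PS) λ eq → ¬attained (S , PS , eq))

  module _ {V : Subset n} (G : Graph V) where

    isClique? : ∀ S → Dec (IsClique G S)
    isClique? S = (S ⊆? V) ×-dec map′
      (λ none {u} {v} u∈ v∈ u≢v → decidable-stable (adj? G u v) λ u≁v →
        none (u , v , u∈ , v∈ , u≢v , u≁v))
      (λ all (u , v , u∈ , v∈ , u≢v , u≁v) → u≁v (all u∈ v∈ u≢v))
      (¬? (any? λ u → any? λ v →
        (u ∈? S) ×-dec (v ∈? S) ×-dec ¬? (u Fin.≟ v) ×-dec ¬? (adj? G u v)))

    simplicial? : ∀ S v → Dec (Simplicial G S v)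
    simplicial? S v = map′
      (λ none {u} {w} u∈ w∈ vu vw u≢w → decidable-stable (adj? G u w) λ u≁w →
        none (u , w , u∈ , w∈ , vu , vw , u≢w , u≁w))
      (λ all (u , w , u∈ , w∈ , vu , vw , u≢w , u≁w) → u≁w (all u∈ w∈ vu vw u≢w))
      (¬? (any? λ u → any? λ w → (u ∈? S) ×-dec (w ∈? S) ×-dec adj? G v u ×-dec adj? G v w
        ×-dec ¬? (u Fin.≟ w) ×-dec ¬? (adj? G u w)))

    hereditarilySimplicial? : Dec (HereditarilySimplicial G)
    hereditarilySimplicial? = allSubsets? λ S → (S ⊆? V) →-dec (nonempty? S →-dec
      any? (λ v → (v ∈? S) ×-dec simplicial? S v))

    dirac⇒chordal : Dirac G → Chordal G
    dirac⇒chordal dirac = hereditarilySimplicial⇒chordal G (dirac⇒hereditarilySimplicial G dirac)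

    -- Chordality speaks of cycles of every length; the equivalent condition on simplicial vertices
    -- ranges only over the finitely many subsets.
    chordal? : Dec (Chordal G)
    chordal? = map′ (hereditarilySimplicial⇒chordal G)
      (λ chordal → dirac⇒hereditarilySimplicial G (chordal⇒dirac G chordal))
      hereditarilySimplicial?

    ⊥-clique : IsClique G ⊥
    ⊥-clique = (λ v∈⊥ → contradiction v∈⊥ ∉⊥) , λ v∈⊥ → contradiction v∈⊥ ∉⊥

    largestCliqueSize : ∃[ m ] LargestCliqueSize G m
    largestCliqueSize = largest isClique? ⊥-clique ∣ V ∣ λ S clique → p⊆q⇒∣p∣≤∣q∣ (proj₁ clique)

    largestCliqueSize? : ∀ m → Dec (LargestCliqueSize G m)
    largestCliqueSize? m = anySubset? (λ S → isClique? S ×-dec (∣ S ∣ ℕ.≟ m)) ×-dec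
      allSubsets? (λ S → isClique? S →-dec (∣ S ∣ ℕ.≤? m))


  module _ {V : Subset n} {H H′ : Graph V} (H⊆H′ : ∀ {u v} → Adj H u v → Adj H′ u v)
           (H′⊆H : ∀ {u v} → Adj H′ u v → Adj H u v) where

    chordal-resp : Chordal H → Chordal H′
    chordal-resp chordal c 3<m (c-inj , edge) with chordal c 3<m (c-inj , H′⊆H ∘ edge)
    ... | i , j , j≢ , i≢ , chord = i , j , j≢ , i≢ , H⊆H′ chord

    largestCliqueSize-resp : ∀ {m} → LargestCliqueSize H m → LargestCliqueSize H′ m
    largestCliqueSize-resp ((S , clique , eq) , bound) =
      (S , clique-resp {P = H′} {R = H} id H′⊆H H⊆H′ clique , eq) ,
      λ T T-clique → bound T (clique-resp {P = H} {R = H′} id H⊆H′ H′⊆H T-clique)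

  -- Every graph on V is encoded by a subset of pairs, so that the triangulations
  -- of a graph can be searched.
  module _ (V : Subset n) where

    -- Accepting a pair in either order and excluding loops makes every `E` the code of a simple
    -- graph.
    decode : Subset (n * n) → Graph V
    decode E = record
      { Adj     = λ u v → u ≢ v × (u ∈ V × v ∈ V) × (pair u v ∈ E ⊎ pair v u ∈ E)
      ; adj?    = λ u v → ¬? (u Fin.≟ v) ×-dec ((u ∈? V) ×-dec (v ∈? V)) ×-dec
                          ((pair u v ∈? E) ⊎-dec (pair v u ∈? E))
      ; adj-sym = λ (u≢v , (u∈ , v∈) , e) → u≢v ∘ sym , (v∈ , u∈) , Sum.swap e
      ; irrefl  = λ eq (u≢v , _) → u≢v eq
      ; within  = λ (_ , uv∈ , _) → uv∈
      }

    module _ (H : Graph V) where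

      private
        edge? : ∀ i → Dec (Adj H (proj₁ (remQuot {n} n i)) (proj₂ (remQuot {n} n i)))
        edge? i = adj? H (proj₁ (remQuot {n} n i)) (proj₂ (remQuot {n} n i))

      encode : Subset (n * n)
      encode = select edge?

      encode⁺ : ∀ {u v} → Adj H u v → pair u v ∈ encode
      encode⁺ {u} {v} uv = ∈-select⁺ edge?
        (subst (λ (u , v) → Adj H u v) (sym (remQuot-combine u v)) uv)

      encode⁻ : ∀ {u v} → pair u v ∈ encode → Adj H u v
      encode⁻ {u} {v} uv∈ = subst (λ (u , v) → Adj H u v) (remQuot-combine u v) (∈-select⁻ edge? uv∈)

      decode-encode⁺ : ∀ {u v} → Adj H u v → Adj (decode encode) u v
      decode-encode⁺ uv = (λ eq → irrefl H eq uv) , within H uv , inj₁ (encode⁺ uv)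

      decode-encode⁻ : ∀ {u v} → Adj (decode encode) u v → Adj H u v
      decode-encode⁻ (_ , _ , e) = [ encode⁻ , adj-sym H ∘ encode⁻ ]′ e

  module _ {V : Subset n} (G : Graph V) where

    isTriangulation? : (H : Graph V) → Dec (IsTriangulation G H)
    isTriangulation? H = map′
      (λ none {u} {v} uv → decidable-stable (adj? H u v) λ u≁v → none (u , v , uv , u≁v))
      (λ G⊆H (u , v , uv , u≁v) → u≁v (G⊆H uv))
      (¬? (any? λ u → any? λ v → adj? G u v ×-dec ¬? (adj? H u v))) ×-dec chordal? H

    private
      HasWidth : ℕ → Set
      HasWidth m = ∃[ E ] IsTriangulation G (decode V E) × LargestCliqueSize (decode V E) m

    hasWidth : ∀ {H m} → IsTriangulation G H → LargestCliqueSize H m → HasWidth m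
    hasWidth {H} (G⊆H , chordal) size = encode V H
      , (decode-encode⁺ V H ∘ G⊆H , chordal-resp {H = H} {decode V (encode V H)} (decode-encode⁺ V H) (decode-encode⁻ V H) chordal)
      , largestCliqueSize-resp {H = H} {decode V (encode V H)} (decode-encode⁺ V H) (decode-encode⁻ V H) size

    complete-triangulation : IsTriangulation G (complete V)
    complete-triangulation =
      (λ uv → (λ eq → irrefl G eq uv) , within G uv) ,
      dirac⇒chordal (complete V) (dirac-complete V)

    -- The complete graph on `V` shows that some width is attained, and attaining a given width is
    -- decidable by searching the codes, so a least one exists.
    cliquewidth : ∃[ w ] IsCliquewidth G w
    cliquewidth =
      let m , size = largestCliqueSize (complete V)
          w , (E , triangulation , w-size) , minimal = least
            (λ m → anySubset? λ E → isTriangulation? (decode V E) ×-dec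
                                    largestCliqueSize? (decode V E) m)
            (hasWidth {complete V} complete-triangulation size)
      in w , (decode V E , triangulation , w-size) , λ H m tri m-size → minimal (hasWidth {H} tri m-size)

-- The algorithm

module Correctness {n k : ℕ} (1≤k : 1 ≤ k) {α : ℝ} (1≤α : 1ℝ ≤ℝ α)
                   (small? : SizeTest k α) (search : Search n k α) where
  open Bounds k 1≤k α 1≤α

  SmallCliques : {V : Subset n} → Graph V → Set
  SmallCliques H = ∀ {K} → IsClique H K → fromℕ ∣ K ∣ <ℝ k · (2 · α +ℝ 1ℝ)

  record Triangulates {V : Subset n} (G : Graph V) (W : Subset n) (H : Graph V) : Set where
    field
      G⊆H      : ∀ {u v} → Adj G u v → Adj H u v
      dirac    : Dirac H
      W-clique : IsClique H W
      small    : SmallCliques H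

  -- The cliquewidth of G exceeds k.
  Wide : {V : Subset n} → Graph V → Set₁
  Wide {V} G = ∀ (H : Graph V) → (∀ {u v} → Adj G u v → Adj H u v) → Dirac H →
               ¬ (∀ {K} → IsClique H K → ∣ K ∣ ≤ k)

  Correct : {V : Subset n} → Graph V → Subset n → Outcome V → Set₁
  Correct {V} G W outcome =
    (∃[ H ] outcome ≡ triangulated H × Triangulates G W H) ⊎ (outcome ≡ cliquewidth>k × Wide G)

  -- A supergraph of `G` with the Dirac property and cliques of at most `k` vertices restricts to
  -- one of `G [ S ]`.
  wide-[] : ∀ {V S : Subset n} {G : Graph V} → S ⊆ V → Wide (G [ S ]) → Wide G
  wide-[] {S = S} S⊆V wide H G⊆H dirac ∣clique∣≤k = wide (H [ S ])
    (λ (uv , uv∈) → G⊆H uv , uv∈) (dirac-[] H S⊆V dirac)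
    (λ (K⊆S , adj) → ∣clique∣≤k (S⊆V ∘ K⊆S , λ u∈ v∈ u≢v → proj₁ (adj u∈ v∈ u≢v)))

  module _ {V : Subset n} (G : Graph V) (D : Decomposition G) {W : Subset n} (W⊆V : W ⊆ V) where
    open Decomposition D

    locate : ∀ {v} → v ∈ V → v ∈ X ⊎ v ∈ A ⊎ v ∈ B ⊎ v ∈ C
    locate {v} v∈V = Sum.map₂ (Sum.map₂ (x∈p∪q⁻ B C) ∘ x∈p∪q⁻ A (B ∪ C))
      (x∈p∪q⁻ X (A ∪ B ∪ C) (subst (v ∈_) (sym partition) v∈V))

    edge-inside : ∀ {u v} → Adj G u v →
                  Adj (G [ A ∪ X ]) u v ⊎ Adj (G [ B ∪ X ]) u v ⊎ Adj (G [ C ∪ X ]) u v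
    edge-inside uv = cases (locate (proj₁ (within G uv))) (locate (proj₂ (within G uv))) uv
      where
      l : ∀ {S v} → v ∈ S → v ∈ S ∪ X
      l = x∈p∪q⁺ ∘ inj₁
      r : ∀ {S v} → v ∈ X → v ∈ S ∪ X
      r = x∈p∪q⁺ ∘ inj₂
      cases : ∀ {u v} → u ∈ X ⊎ u ∈ A ⊎ u ∈ B ⊎ u ∈ C → v ∈ X ⊎ v ∈ A ⊎ v ∈ B ⊎ v ∈ C →
              Adj G u v → Adj (G [ A ∪ X ]) u v ⊎ Adj (G [ B ∪ X ]) u v ⊎ Adj (G [ C ∪ X ]) u v
      cases (inj₁ u∈X) (inj₁ v∈X) e = inj₁ (e , r u∈X , r v∈X)
      cases (inj₁ u∈X) (inj₂ (inj₁ v∈A)) e = inj₁ (e , r u∈X , l v∈A)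
      cases (inj₁ u∈X) (inj₂ (inj₂ (inj₁ v∈B))) e = inj₂ (inj₁ (e , r u∈X , l v∈B))
      cases (inj₁ u∈X) (inj₂ (inj₂ (inj₂ v∈C))) e = inj₂ (inj₂ (e , r u∈X , l v∈C))
      cases (inj₂ (inj₁ u∈A)) (inj₁ v∈X) e = inj₁ (e , l u∈A , r v∈X)
      cases (inj₂ (inj₂ (inj₁ u∈B))) (inj₁ v∈X) e = inj₂ (inj₁ (e , l u∈B , r v∈X))
      cases (inj₂ (inj₂ (inj₂ u∈C))) (inj₁ v∈X) e = inj₂ (inj₂ (e , l u∈C , r v∈X))
      cases (inj₂ (inj₁ u∈A)) (inj₂ (inj₁ v∈A)) e = inj₁ (e , l u∈A , l v∈A)
      cases (inj₂ (inj₂ (inj₁ u∈B))) (inj₂ (inj₂ (inj₁ v∈B))) e = inj₂ (inj₁ (e , l u∈B , l v∈B))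
      cases (inj₂ (inj₂ (inj₂ u∈C))) (inj₂ (inj₂ (inj₂ v∈C))) e = inj₂ (inj₂ (e , l u∈C , l v∈C))
      cases (inj₂ (inj₁ u∈A)) (inj₂ (inj₂ (inj₁ v∈B))) e = contradiction e (A-B u∈A v∈B)
      cases (inj₂ (inj₁ u∈A)) (inj₂ (inj₂ (inj₂ v∈C))) e = contradiction e (A-C u∈A v∈C)
      cases (inj₂ (inj₂ (inj₁ u∈B))) (inj₂ (inj₂ (inj₂ v∈C))) e = contradiction e (B-C u∈B v∈C)
      cases (inj₂ (inj₂ (inj₁ u∈B))) (inj₂ (inj₁ v∈A)) e = contradiction (adj-sym G e) (A-B v∈A u∈B)
      cases (inj₂ (inj₂ (inj₂ u∈C))) (inj₂ (inj₁ v∈A)) e = contradiction (adj-sym G e) (A-C v∈A u∈C)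
      cases (inj₂ (inj₂ (inj₂ u∈C))) (inj₂ (inj₂ (inj₁ v∈B))) e = contradiction (adj-sym G e) (B-C v∈B u∈C)

    -- The result has the same edges as `U₃`, obtained from the clique on `W ∪ X` by three
    -- successive clique sums. Each sum preserves the Dirac property and creates no clique beyond
    -- those of its pieces.
    triangulates-combine : fromℕ ∣ W ∣ <ℝ k · (α +ℝ 1ℝ) → fromℕ ∣ X ∣ ≤ℝ k · α →
      ∀ {H₁ H₂ H₃} → Triangulates (G [ A ∪ X ]) ((W ∩ A) ∪ X) H₁ →
      Triangulates (G [ B ∪ X ]) ((W ∩ B) ∪ X) H₂ → Triangulates (G [ C ∪ X ]) ((W ∩ C) ∪ X) H₃ →
      Triangulates G W (addEdges (addEdges (addEdges (addEdges G
        (A∪X⊆V D) H₁) (B∪X⊆V D) H₂) (C∪X⊆V D) H₃) (W∪X⊆V D W⊆V) (complete (W ∪ X)))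
    triangulates-combine W-small X-small {H₁} {H₂} {H₃} t₁ t₂ t₃ = record
      { G⊆H      = inj₁ ∘ inj₁ ∘ inj₁ ∘ inj₁
      ; dirac    = dirac-resp {P = U₃} {R = H} V⊆ U₃⊆H H⊆U₃
          (dirac-sum sum₃ (dirac-sum sum₂ (dirac-sum sum₁ (dirac-complete (W ∪ X))
            T₁.dirac) T₂.dirac) T₃.dirac)
      ; W-clique = W⊆V , λ u∈ v∈ u≢v → inj₂ (u≢v , x∈p∪q⁺ (inj₁ u∈) , x∈p∪q⁺ (inj₁ v∈))
      ; small    = λ K-clique → [ [ [ small₀ , T₁.small ]′ ∘ clique-split sum₁ , T₂.small ]′
                                  ∘ clique-split sum₂ , T₃.small ]′
                      (clique-split sum₃ (clique-resp {P = U₃} {R = H} V⊆ U₃⊆H H⊆U₃ K-clique))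
      }
      where
      module T₁ = Triangulates t₁
      module T₂ = Triangulates t₂
      module T₃ = Triangulates t₃

      Z : Graph (W ∪ X)
      Z = complete (W ∪ X)
      H : Graph V
      H = addEdges (addEdges (addEdges (addEdges G (A∪X⊆V D) H₁) (B∪X⊆V D) H₂) (C∪X⊆V D) H₃)
            (W∪X⊆V D W⊆V) Z
      U₁ : Graph ((W ∪ X) ∪ (A ∪ X))
      U₁ = Z ∪ᴳ H₁
      U₂ : Graph (((W ∪ X) ∪ (A ∪ X)) ∪ (B ∪ X))
      U₂ = U₁ ∪ᴳ H₂
      U₃ : Graph ((((W ∪ X) ∪ (A ∪ X)) ∪ (B ∪ X)) ∪ (C ∪ X))
      U₃ = U₂ ∪ᴳ H₃

      -- The part S ∪ X meets W and the parts glued before it in W ∩ S and X only.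
      meet : ∀ {S T v} → DisjointSets T S → v ∈ T ∪ X → v ∈ S ∪ X → v ∈ (W ∩ S) ∪ X
      meet {S} {T} T∩S=∅ v∈ v∈′ = x∈p∪q⁺ (inj₂
        ([ (λ v∈T → [ (λ v∈S → contradiction v∈S (T∩S=∅ v∈T)) , id ]′ (x∈p∪q⁻ S X v∈′)) , id ]′
          (x∈p∪q⁻ T X v∈)))

      meet-W : ∀ {S v} → v ∈ W ∪ X → v ∈ S ∪ X → v ∈ (W ∩ S) ∪ X
      meet-W {S} v∈ v∈′ = x∈p∪q⁺ (both (x∈p∪q⁻ W X v∈) (x∈p∪q⁻ S X v∈′))
        where
        both : ∀ {v} → v ∈ W ⊎ v ∈ X → v ∈ S ⊎ v ∈ X → v ∈ W ∩ S ⊎ v ∈ X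
        both (inj₁ v∈W) (inj₁ v∈S) = inj₁ (x∈p∩q⁺ (v∈W , v∈S))
        both (inj₂ v∈X) _          = inj₂ v∈X
        both _          (inj₂ v∈X) = inj₂ v∈X

      W∩S∪X⊆W∪X : ∀ {S} → (W ∩ S) ∪ X ⊆ W ∪ X
      W∩S∪X⊆W∪X {S} = x∈p∪q⁺ ∘ Sum.map₁ (proj₁ ∘ x∈p∩q⁻ W S) ∘ x∈p∪q⁻ (W ∩ S) X

      Z-clique : ∀ {S} → IsClique Z ((W ∩ S) ∪ X)
      Z-clique {S} = clique-⊆ Z (W∩S∪X⊆W∪X {S}) (clique-complete (W ∪ X))

      lift : ∀ {P Q : Subset n} {F : Graph P} {F′ : Graph Q} {K} → P ⊆ Q →
             (∀ {u v} → Adj F u v → Adj F′ u v) → IsClique F K → IsClique F′ K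
      lift P⊆Q F⊆F′ (K⊆P , adj) = P⊆Q ∘ K⊆P , λ u∈ v∈ u≢v → F⊆F′ (adj u∈ v∈ u≢v)

      ∪-inj : ∀ {P Q : Subset n} → P ⊆ P ∪ Q
      ∪-inj = x∈p∪q⁺ ∘ inj₁

      cut₁ : (W ∪ X) ∩ (A ∪ X) ⊆ (W ∩ A) ∪ X
      cut₁ v∈ = let (v∈W∪X , v∈A∪X) = x∈p∩q⁻ (W ∪ X) (A ∪ X) v∈ in meet-W v∈W∪X v∈A∪X

      cut₂ : ((W ∪ X) ∪ (A ∪ X)) ∩ (B ∪ X) ⊆ (W ∩ B) ∪ X
      cut₂ v∈ = let (v∈ˡ , v∈B∪X) = x∈p∩q⁻ ((W ∪ X) ∪ (A ∪ X)) (B ∪ X) v∈ in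
        [ (λ v∈W∪X → meet-W v∈W∪X v∈B∪X) , (λ v∈A∪X → meet A∩B=∅ v∈A∪X v∈B∪X) ]′
          (x∈p∪q⁻ (W ∪ X) (A ∪ X) v∈ˡ)

      cut₃ : (((W ∪ X) ∪ (A ∪ X)) ∪ (B ∪ X)) ∩ (C ∪ X) ⊆ (W ∩ C) ∪ X
      cut₃ v∈ = let (v∈ˡ , v∈C∪X) = x∈p∩q⁻ (((W ∪ X) ∪ (A ∪ X)) ∪ (B ∪ X)) (C ∪ X) v∈ in
        [ [ (λ v∈W∪X → meet-W v∈W∪X v∈C∪X) , (λ v∈A∪X → meet A∩C=∅ v∈A∪X v∈C∪X) ]′
            ∘ x∈p∪q⁻ (W ∪ X) (A ∪ X)
        , (λ v∈B∪X → meet B∩C=∅ v∈B∪X v∈C∪X) ]′ (x∈p∪q⁻ ((W ∪ X) ∪ (A ∪ X)) (B ∪ X) v∈ˡ)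

      sum₁ : CliqueSum Z H₁ U₁
      sum₁ = cliqueSum-∪ᴳ (clique-⊆ Z cut₁ Z-clique) (clique-⊆ H₁ cut₁ T₁.W-clique)

      sum₂ : CliqueSum U₁ H₂ U₂
      sum₂ = cliqueSum-∪ᴳ
        (clique-⊆ U₁ cut₂ (lift {F = Z} {U₁} ∪-inj inj₁ Z-clique))
        (clique-⊆ H₂ cut₂ T₂.W-clique)

      sum₃ : CliqueSum U₂ H₃ U₃
      sum₃ = cliqueSum-∪ᴳ
        (clique-⊆ U₂ cut₃ (lift {F = Z} {U₂} (∪-inj ∘ ∪-inj) (inj₁ ∘ inj₁) Z-clique))
        (clique-⊆ H₃ cut₃ T₃.W-clique)

      V⊆ : V ⊆ (((W ∪ X) ∪ (A ∪ X)) ∪ (B ∪ X)) ∪ (C ∪ X)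
      V⊆ v∈V = [ ∪-inj ∘ ∪-inj ∘ ∪-inj ∘ x∈p∪q⁺ ∘ inj₂
               , [ ∪-inj ∘ ∪-inj ∘ x∈p∪q⁺ ∘ inj₂ ∘ ∪-inj
               , [ ∪-inj ∘ x∈p∪q⁺ ∘ inj₂ ∘ ∪-inj
               , x∈p∪q⁺ ∘ inj₂ ∘ ∪-inj ]′ ]′ ]′ (locate v∈V)

      U₃⊆H : ∀ {u v} → Adj U₃ u v → Adj H u v
      U₃⊆H (inj₁ (inj₁ (inj₁ z)))  = inj₂ z
      U₃⊆H (inj₁ (inj₁ (inj₂ h₁))) = inj₁ (inj₁ (inj₁ (inj₂ h₁)))
      U₃⊆H (inj₁ (inj₂ h₂))        = inj₁ (inj₁ (inj₂ h₂))
      U₃⊆H (inj₂ h₃)               = inj₁ (inj₂ h₃)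

      H⊆U₃ : ∀ {u v} → Adj H u v → Adj U₃ u v
      H⊆U₃ (inj₁ (inj₁ (inj₁ (inj₁ g)))) =
        -- No edge of `G` joins two different parts, so each lies in one induced subgraph and hence
        -- in its triangulation.
        [ inj₁ ∘ inj₁ ∘ inj₂ ∘ T₁.G⊆H , [ inj₁ ∘ inj₂ ∘ T₂.G⊆H , inj₂ ∘ T₃.G⊆H ]′ ]′ (edge-inside g)
      H⊆U₃ (inj₁ (inj₁ (inj₁ (inj₂ h₁)))) = inj₁ (inj₁ (inj₂ h₁))
      H⊆U₃ (inj₁ (inj₁ (inj₂ h₂)))        = inj₁ (inj₂ h₂)
      H⊆U₃ (inj₁ (inj₂ h₃))               = inj₂ h₃
      H⊆U₃ (inj₂ z)                       = inj₁ (inj₁ (inj₁ z))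

      small₀ : SmallCliques Z
      small₀ {K} (K⊆ , _) = <ℝ-downward {x = k · (2 · α +ℝ 1ℝ)}
        (ℕ.≤-trans (p⊆q⇒∣p∣≤∣q∣ K⊆) (∣p∪q∣≤∣p∣+∣q∣ W X))
        (<kα+k∧≤kα⇒<2kα+k {∣ W ∣} {∣ X ∣} W-small X-small)

    correct-combine : fromℕ ∣ W ∣ <ℝ k · (α +ℝ 1ℝ) → fromℕ ∣ X ∣ ≤ℝ k · α → ∀ {o₁ o₂ o₃} →
      Correct (G [ A ∪ X ]) ((W ∩ A) ∪ X) o₁ → Correct (G [ B ∪ X ]) ((W ∩ B) ∪ X) o₂ →
      Correct (G [ C ∪ X ]) ((W ∩ C) ∪ X) o₃ →
      Correct G W (combine k α small? search G D W W⊆V o₁ o₂ o₃)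
    correct-combine W-small X-small (inj₁ (H₁ , refl , t₁)) (inj₁ (H₂ , refl , t₂)) (inj₁ (H₃ , refl , t₃)) =
      inj₁ (_ , refl , triangulates-combine W-small X-small t₁ t₂ t₃)
    correct-combine _ _ (inj₂ (refl , wide)) _ _ = inj₂ (refl , wide-[] {G = G} (A∪X⊆V D) wide)
    correct-combine _ _ (inj₁ (_ , refl , _)) (inj₂ (refl , wide)) _ =
      inj₂ (refl , wide-[] {G = G} (B∪X⊆V D) wide)
    correct-combine _ _ (inj₁ (_ , refl , _)) (inj₁ (_ , refl , _)) (inj₂ (refl , wide)) =
      inj₂ (refl , wide-[] {G = G} (C∪X⊆V D) wide)

  triangulates-complete : ∀ {V W : Subset n} (G : Graph V) → W ⊆ V →
    fromℕ ∣ V ∣ <ℝ k · (2 · α +ℝ 1ℝ) → Triangulates G W (addEdges G id (complete V))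
  triangulates-complete {V} G W⊆V V-small = record
    { G⊆H      = inj₁
    ; dirac    = dirac-resp {P = complete V} {R = addEdges G id (complete V)} id inj₂
        [ (λ uv → (λ eq → irrefl G eq uv) , within G uv) , id ]′ (dirac-complete V)
    ; W-clique = W⊆V , λ u∈ v∈ u≢v → inj₂ (u≢v , W⊆V u∈ , W⊆V v∈)
    ; small    = λ (K⊆V , _) →
        <ℝ-downward {x = k · (2 · α +ℝ 1ℝ)} (p⊆q⇒∣p∣≤∣q∣ K⊆V) V-small
    }

  -- A Dirac supergraph with cliques of at most `k` vertices would yield a balanced decomposition,
  -- whose sizes make it a W-decomposition by α ≥ 1.
  wide : ∀ {V W : Subset n} (G : Graph V) → k < ∣ V ∣ → fromℕ ∣ W ∣ <ℝ k · (α +ℝ 1ℝ) →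
         ¬ WDecomposition k α G W → Wide G
  wide {W = W} G k<∣V∣ W-small none H G⊆H dirac ∣clique∣≤k = none (decomposition , record
    { W-small = W-small
    ; X-small = ≤k⇒≤kα ∣X∣≤k
    ; WA-small = part-small A-fits
    ; WB-small = part-small B-fits
    ; WC-small = part-small C-fits
    })
    where
    open BalancedDecomposition (balancedDecomposition {G = G} {H} G⊆H dirac ∣clique∣≤k k<∣V∣ W)
    part-small : ∀ {S} → Fits G k W X S → fromℕ ∣ (W ∩ S) ∪ X ∣ <ℝ k · (α +ℝ 1ℝ)
    part-small {S} (inj₁ light) = <ℝ-downward {x = k · (α +ℝ 1ℝ)}
      (∣p∪q∣≤∣p∣+∣q∣ (W ∩ S) X) (half+k<kα+k {∣ W ∣} {∣ W ∩ S ∣} W-small light ∣X∣≤k)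
    part-small {S} (inj₂ S∪X≤k) =
      ≤k⇒<kα+k (ℕ.≤-trans (p⊆q⇒∣p∣≤∣q∣ (W∩S∪X⊆S∪X W S X)) S∪X≤k)

  -- The three mutually dependent statements follow the three functions of the algorithm; taking the
  -- decision `d` as an argument lets the outcome compute by cases on it.
  correct : ∀ {V : Subset n} (G : Graph V) (W : Subset n) (W⊆V : W ⊆ V) (a : Acc _<_ ∣ V ∣) →
            fromℕ ∣ W ∣ <ℝ k · (α +ℝ 1ℝ) → Correct G W (triangulateAcc k α small? search G W W⊆V a)

  correct-test : ∀ {V : Subset n} (G : Graph V) (W : Subset n) (W⊆V : W ⊆ V)
    (rs : ∀ {m} → m < ∣ V ∣ → Acc _<_ m) → fromℕ ∣ W ∣ <ℝ k · (α +ℝ 1ℝ) →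
    (d : Dec (fromℕ ∣ V ∣ <ℝ k · (2 · α +ℝ 1ℝ))) →
    Correct G W (afterTest k α small? search G W W⊆V rs d)

  correct-search : ∀ {V : Subset n} (G : Graph V) (W : Subset n) (W⊆V : W ⊆ V)
    (rs : ∀ {m} → m < ∣ V ∣ → Acc _<_ m) → fromℕ ∣ W ∣ <ℝ k · (α +ℝ 1ℝ) → k < ∣ V ∣ →
    (d : Dec (WDecomposition k α G W)) →
    Correct G W (afterSearch k α small? search G W W⊆V rs d)

  correct {V} G W W⊆V (acc rs) W-small = correct-test G W W⊆V rs W-small (small? ∣ V ∣)

  correct-test G W W⊆V rs W-small (yes V-small) =
    inj₁ (_ , refl , triangulates-complete G W⊆V V-small)
  correct-test G W W⊆V rs W-small (no large) = correct-search G W W⊆V rs W-small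
    -- At most `k` vertices would be fewer than `(2α + 1)k`, against the failed size test.
    (ℕ.≰⇒> (large ∘ ≤k⇒<2kα+k)) (search G large W W⊆V)

  correct-search G W W⊆V rs W-small k<∣V∣ (no none) = inj₂ (refl , wide G k<∣V∣ W-small none)
  correct-search G W W⊆V rs W-small k<∣V∣ (yes (D , w)) =
    correct-combine G D W⊆V W-small X-small
      (correct (G [ A ∪ X ]) ((W ∩ A) ∪ X) (W∩S∪X⊆S∪X W A X) (rs (∣A∪X∣<∣V∣ D)) WA-small)
      (correct (G [ B ∪ X ]) ((W ∩ B) ∪ X) (W∩S∪X⊆S∪X W B X) (rs (∣B∪X∣<∣V∣ D)) WB-small)
      (correct (G [ C ∪ X ]) ((W ∩ C) ∪ X) (W∩S∪X⊆S∪X W C X) (rs (∣C∪X∣<∣V∣ D)) WC-small)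
    where
    open Decomposition D
    open IsWDecomposition w using (X-small; WA-small; WB-small; WC-small)

  -- A triangulation attaining the cliquewidth has the Dirac property by chordality, so its largest
  -- clique cannot have at most `k` vertices.
  wide⇒cliquewidth>k : ∀ {V : Subset n} (G : Graph V) → Wide G → ∃[ w ] IsCliquewidth G w × k < w
  wide⇒cliquewidth>k G wide =
    let w , isCliquewidth@((H , (G⊆H , chordal) , _ , bound) , _) = cliquewidth G
    in w , isCliquewidth , ℕ.≰⇒> λ w≤k →
         wide H G⊆H (chordal⇒dirac H chordal) (λ {K} clique → ℕ.≤-trans (bound K clique) w≤k)

theorem3 : ∀ {n : ℕ} {V : Subset n} (G : Graph V)
    (k : ℕ) → 1 ≤ k →
    (α : ℝ) → 1ℝ ≤ℝ α →
    (W : Subset n) (W⊆V : W ⊆ V) → fromℕ ∣ W ∣ <ℝ k · (α +ℝ 1ℝ) →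
    (small? : SizeTest k α) (search : Search n k α) →
    (∃[ H ] triangulate k α small? search G W W⊆V ≡ triangulated H
    × IsTriangulation G H
    × IsClique H W
    × (∃[ m ] LargestCliqueSize H m × fromℕ m <ℝ k · (2 · α +ℝ 1ℝ)))
    ⊎
    (triangulate k α small? search G W W⊆V ≡ cliquewidth>k
    × (∃[ w ] IsCliquewidth G w × k < w))
theorem3 {V = V} G k 1≤k α 1≤α W W⊆V W-small small? search =
  Sum.map success (λ (eq , wide) → eq , wide⇒cliquewidth>k G wide)
    (correct G W W⊆V (<-wellFounded ∣ V ∣) W-small)
  where
  open Correctness 1≤k 1≤α small? search
  success : (∃[ H ] triangulate k α small? search G W W⊆V ≡ triangulated H × Triangulates G W H) →
            ∃[ H ] triangulate k α small? search G W W⊆V ≡ triangulated H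
              × IsTriangulation G H × IsClique H W
              × (∃[ m ] LargestCliqueSize H m × fromℕ m <ℝ k · (2 · α +ℝ 1ℝ))
  success (H , eq , t) =
    let open Triangulates t
        m , size@((S , clique , ∣S∣≡m) , _) = largestCliqueSize H
    in H , eq , (G⊆H , dirac⇒chordal H dirac) , W-clique ,
       m , size , subst (λ m → fromℕ m <ℝ k · (2 · α +ℝ 1ℝ)) ∣S∣≡m (small clique)
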